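{- For every positive integer $v\notin\{2,6,8\}$ there exists a PBD$(v,\{3,4,5\})$ in which any three points generate a flat of size at most $63$, unless $v-[e]_4\in\{1,3,9\}$ for some integer $e\ge 3$, in which case there exists a PBD$(v,\{3,4,5\})$ in which any three points generate a flat of size at most $94$.
   Context: A PBD$(v,K)$ is a pair $(X,\mathcal{B})$ with $|X|=v$ and $\mathcal{B}$ a family of subsets (blocks) of $X$ with sizes in $K$, such that every pair of distinct points lies in exactly one block. A flat is a subset $Y\subseteq X$ such that any two distinct points of $Y$ lie in a block contained in $Y$; the flat generated by a set $S$ is the intersection of all flats containing $S$. For an integer $e\ge0$, $[e]_4=1+4+4^2+\cdots+4^e$. -}

module Defs where

open import Data.Nat using (ℕ; zero; suc; _+_; _*_; _≤_)
open import Data.Fin using (Fin)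
open import Data.Fin.Subset using (Subset; _∈_; _⊆_; ∣_∣; ⁅_⁆; _∪_)
open import Data.Product using (Σ; ∃; _×_; _,_)
open import Data.Sum using (_⊎_)
open import Relation.Binary.PropositionalEquality using (_≡_; _≢_)
open import Function.Bundles using (_⇔_)

[_]₄ : ℕ → ℕ
[ zero ]₄  = 1
[ suc e ]₄ = 1 + 4 * [ e ]₄

InK : ℕ → Set
InK k = (k ≡ 3) ⊎ (k ≡ 4) ⊎ (k ≡ 5)

record PBD345 (v : ℕ) : Set where
  field
    nblocks   : ℕ
    block     : Fin nblocks → Subset v
    blockSize : ∀ i → InK ∣ block i ∣
    cover     : ∀ (x y : Fin v) → x ≢ y →
                Σ (Fin nblocks) λ i → (x ∈ block i) × (y ∈ block i)
                  × (∀ j → x ∈ block j → y ∈ block j → j ≡ i)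
open PBD345 public

IsFlat : ∀ {v} → PBD345 v → Subset v → Set
IsFlat D Y = ∀ x y → x ∈ Y → y ∈ Y → x ≢ y →
  Σ (Fin (nblocks D)) λ i → (x ∈ block D i) × (y ∈ block D i) × (block D i ⊆ Y)

IsGeneratedFlat : ∀ {v} → PBD345 v → Subset v → Subset v → Set
IsGeneratedFlat D S F = ∀ p → (p ∈ F) ⇔ (∀ Y → IsFlat D Y → S ⊆ Y → p ∈ Y)

ThreeGenBound : ∀ {v} → PBD345 v → ℕ → Set
ThreeGenBound {v} D m = ∀ (x y z : Fin v) (F : Subset v) →
  IsGeneratedFlat D (⁅ x ⁆ ∪ ⁅ y ⁆ ∪ ⁅ z ⁆) F → ∣ F ∣ ≤ m

Exceptional : ℕ → Set
Exceptional v = ∃ λ e → 3 ≤ e × ((v ≡ [ e ]₄ + 1) ⊎ (v ≡ [ e ]₄ + 3) ⊎ (v ≡ [ e ]₄ + 9))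

-- Give the points of PG(n,4) weights, replace a point of weight w by w copies of it, and put on the copies of
-- each line a group divisible design whose groups are the copies of its five points.  Three points of the
-- resulting PBD lie over a plane, so they generate a flat of at most 21 · 3 = 63 points when all weights are at
-- most 3.  Weights 0, 1, 3 are enough.  With r = [n]₄ the following orders arise.
--   r + 2m: weights 1 and 3 only.
--   4r + 2(3m + k) with k ≤ m ≤ r: the same in PG(n+1,4) with one point of weight 0, the lines through which have
--   total weight 4, 10 or 12.
--   15 · 4ᵏ to 21 · 4ᵏ: weights 0 and 1 in PG(k+2,4), viewed as a cone over PG(2,4) with vertex PG(k-1,4) of weight
--   0.  A line of PG(2,4) has at most two points on a given hyperoval, so each fibre over a point of the hyperoval
--   may be thinned out to any set meeting every line through the vertex in 0, 1, 3 or 4 points of the fibre.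
--   21 · 4ᵏ to [k+2]₄: the affine space of 4ᵏ⁺² points over a hyperplane of the previous kind.
-- Between [n]₄ and [n+1]₄ this misses only [n]₄ + 1, [n]₄ + 3, [n]₄ + 9 and a few small orders.  The former are
-- 4 [n-1]₄ + m with m = 2, 4, 10, where PG(n-1,4) is taken with m points of weight 5 and the others of weight 4.
module Submission where

open import Defs
open import Data.Bool using (Bool; true; false; T; if_then_else_; _∨_)
open import Data.Empty using (⊥; ⊥-elim)
open import Data.Fin using (Fin; zero; suc; toℕ; fromℕ<)
open import Data.Fin.Patterns using (0F; 1F; 2F; 3F; 4F; 5F; 6F; 7F)
open import Data.Fin.Subset using (Subset; ∣_∣; ⁅_⁆; _∪_) renaming (_∈_ to _∈ₛ_; _⊆_ to _⊆ₛ_)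
open import Data.Fin.Subset.Properties using (p⊆q⇒∣p∣≤∣q∣; ∣p∣≤n; x∈⁅y⁆⇒x≡y; x∈p∪q⁻)
open import Data.List using (List; []; _∷_; [_]; _++_; map; concatMap; filter; length; lookup; take; upTo; deduplicate; allFin; mapMaybe; cartesianProduct; cartesianProductWith)
open import Data.List.Membership.Propositional using (_∈_; find; lose)
open import Data.List.Relation.Unary.All as All using (All; []; _∷_)
open import Data.List.Relation.Unary.Any as Any using (Any; here; there)
open import Data.List.Relation.Unary.AllPairs as AllPairs using (AllPairs; []; _∷_)
open import Data.List.Relation.Unary.Unique.Propositional using (Unique)
open import Data.Maybe as Maybe using (Maybe; just; nothing)
open import Data.Nat using (ℕ; zero; suc; _+_; _*_; _∸_; _^_; _≤_; _<_; z≤n; s≤s; _≤?_; _<?_; _<ᵇ_; _⊓_)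
open import Data.Nat.DivMod using (_/_; _%_; _divMod_; result)
open import Data.Nat.ListAction using (sum)
open import Data.Nat.Solver using (module +-*-Solver)
open import Data.Product using (∃; ∃₂; _×_; _,_; proj₁; proj₂)
open import Data.Sum using (_⊎_; inj₁; inj₂)
open import Data.Unit using (⊤; tt)
open import Data.Vec as Vec using (Vec; []; _∷_)
open import Function using (_∘_; id; case_of_)
open import Function.Bundles using (Equivalence)
open import Relation.Binary.Definitions using (DecidableEquality)
open import Relation.Binary.PropositionalEquality using (_≡_; _≢_; refl; sym; trans; cong; cong₂; subst; subst₂; module ≡-Reasoning)
open import Relation.Nullary using (¬_; Dec; yes; no; does; contradiction)
open import Relation.Nullary.Decidable using (True; toWitness; map′; dec-true; dec-false; _×-dec_; _⊎-dec_; _→-dec_; ¬?)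
import Data.Bool.Properties as Boolₚ
import Data.Fin.Properties as Finₚ
import Data.List.Membership.DecPropositional as DecMembership
import Data.List.Membership.Propositional.Properties as Memₚ
import Data.List.Properties as Listₚ
import Data.List.Relation.Unary.All.Properties as Allₚ
import Data.List.Relation.Unary.AllPairs.Properties as AllPairsₚ
import Data.List.Relation.Unary.Any.Properties as Anyₚ
import Data.List.Relation.Unary.Unique.DecPropositional.Properties as Uniqueᵈₚ
import Data.List.Relation.Unary.Unique.Propositional.Properties as Uniqueₚ
import Data.Nat.ListAction.Properties as Sumₚ
import Data.Nat.Properties as ℕₚ
import Data.Product.Properties as Productₚ
import Data.Vec.Properties as Vecₚ

-- From designs on lists to PBD345

∈-index-lookup : ∀ {A : Set} {xs : List A} {x} (p : x ∈ xs) → lookup xs (Any.index p) ≡ x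
∈-index-lookup p = sym (Anyₚ.lookup-index p)

lookup-injective : ∀ {A : Set} {xs : List A} → Unique xs → ∀ {i j} → lookup xs i ≡ lookup xs j → i ≡ j
lookup-injective {xs = _ ∷ _}  _          {zero}  {zero}  _  = refl
lookup-injective {xs = _ ∷ xs} (x∉xs ∷ _) {zero}  {suc j} eq = contradiction eq (All.lookup x∉xs (Memₚ.∈-lookup {xs = xs} j))
lookup-injective {xs = _ ∷ xs} (x∉xs ∷ _) {suc i} {zero}  eq = contradiction (sym eq) (All.lookup x∉xs (Memₚ.∈-lookup {xs = xs} i))
lookup-injective {xs = _ ∷ _}  (_ ∷ xs!)  {suc _} {suc _} eq = cong suc (lookup-injective xs! eq)

Unique-⊆-length : ∀ {A : Set} {xs ys : List A} → Unique xs → (∀ {x} → x ∈ xs → x ∈ ys) → length xs ≤ length ys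
Unique-⊆-length {xs = xs} {ys} xs! xs⊆ys = Finₚ.injective⇒≤ {f = f} f-injective
  where
  f : Fin (length xs) → Fin (length ys)
  f i = Any.index (xs⊆ys (Memₚ.∈-lookup {xs = xs} i))
  f-injective : ∀ {i j} → f i ≡ f j → i ≡ j
  f-injective {i} {j} eq = lookup-injective xs! (begin
    lookup xs i      ≡⟨ ∈-index-lookup (xs⊆ys (Memₚ.∈-lookup i)) ⟨
    lookup ys (f i)  ≡⟨ cong (lookup ys) eq ⟩
    lookup ys (f j)  ≡⟨ ∈-index-lookup (xs⊆ys (Memₚ.∈-lookup j)) ⟩
    lookup xs j      ∎)
    where open ≡-Reasoning

-- Blocks form a predicate, so that a construction can describe them without listing them; `ToPBD`
-- extracts a list free of duplicates.
record Design {A : Set} (xs : List A) : Set₁ where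
  field
    IsBlock : List A → Set
    block-⊆ : ∀ {b} → IsBlock b → ∀ {x} → x ∈ b → x ∈ xs
    block-! : ∀ {b} → IsBlock b → Unique b
    block-size : ∀ {b} → IsBlock b → InK (length b)
    join : ∀ {x y} → x ∈ xs → y ∈ xs → x ≢ y → ∃ λ b → IsBlock b × x ∈ b × y ∈ b
    meet : ∀ {b c x y} → IsBlock b → IsBlock c → x ≢ y → x ∈ b → y ∈ b → x ∈ c → y ∈ c → b ≡ c

  -- Certificate for a bound on the generated flat: `In` is closed under the blocks and contains the
  -- three points, so it contains the flat that they generate, and `cover` bounds its size.
  record Hull (x y z : A) (m : ℕ) : Set₁ where
    field
      In : A → Set
      in? : ∀ a → Dec (In a)
      x-in : In x
      y-in : In y
      z-in : In z
      closed : ∀ {b u v} → IsBlock b → u ≢ v → u ∈ b → v ∈ b → In u → In v → ∀ {a} → a ∈ b → In a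
      cover : List A
      covered : ∀ {a} → a ∈ xs → In a → a ∈ cover
      cover-size : length cover ≤ m

module ToPBD {A : Set} (_≟_ : DecidableEquality A) {xs : List A} (xs! : Unique xs) (D : Design xs) where
  open Design D
  open DecMembership _≟_ using (_∈?_)

  v : ℕ
  v = length xs

  at : Fin v → A
  at = lookup xs

  at∈ : ∀ i → at i ∈ xs
  at∈ i = Memₚ.∈-lookup {xs = xs} i

  module _ {P : A → Set} (P? : ∀ a → Dec (P a)) where
    subset : Subset v
    subset = Vec.tabulate (does ∘ P? ∘ at)

    subset⁺ : ∀ {i} → P (at i) → i ∈ₛ subset
    subset⁺ {i} p = Vecₚ.lookup⇒[]= i subset (trans (Vecₚ.lookup∘tabulate _ i) (dec-true (P? (at i)) p))

    subset⁻ : ∀ {i} → i ∈ₛ subset → P (at i)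
    subset⁻ {i} i∈ with P? (at i) | trans (sym (Vecₚ.lookup∘tabulate (does ∘ P? ∘ at) i)) (Vecₚ.[]=⇒lookup i∈)
    ... | yes p | _ = p

    ∣tabulate∣ : ∀ ys → ∣ Vec.tabulate (does ∘ P? ∘ lookup ys) ∣ ≡ length (filter P? ys)
    ∣tabulate∣ []       = refl
    ∣tabulate∣ (y ∷ ys) with P? y
    ... | yes _ = cong suc (∣tabulate∣ ys)
    ... | no  _ = ∣tabulate∣ ys

    ∣subset∣≤ : ∀ {ys} → (∀ {a} → a ∈ xs → P a → a ∈ ys) → ∣ subset ∣ ≤ length ys
    ∣subset∣≤ {ys} P⊆ys = subst (_≤ length ys) (sym (∣tabulate∣ xs))
      (Unique-⊆-length (Uniqueₚ.filter⁺ P? xs!) λ a∈ → case Memₚ.∈-filter⁻ P? {xs = xs} a∈ of λ (a∈xs , Pa) → P⊆ys a∈xs Pa)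

    ≤∣subset∣ : ∀ {ys} → Unique ys → (∀ {a} → a ∈ ys → a ∈ xs × P a) → length ys ≤ ∣ subset ∣
    ≤∣subset∣ {ys} ys! ys⊆P = subst (length ys ≤_) (sym (∣tabulate∣ xs))
      (Unique-⊆-length ys! λ a∈ → case ys⊆P a∈ of λ (a∈xs , Pa) → Memₚ.∈-filter⁺ P? a∈xs Pa)

  blockSubset : List A → Subset v
  blockSubset b = subset (_∈? b)

  ∣blockSubset∣ : ∀ {b} → IsBlock b → ∣ blockSubset b ∣ ≡ length b
  ∣blockSubset∣ {b} B = ℕₚ.≤-antisym (∣subset∣≤ (_∈? b) λ _ a∈b → a∈b)
    (≤∣subset∣ (_∈? b) (block-! B) λ a∈b → block-⊆ B a∈b , a∈b)

  joining : (i j : Fin v) → i ≢ j → ∃ λ b → IsBlock b × at i ∈ b × at j ∈ b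
  joining i j i≢j = join (at∈ i) (at∈ j) (i≢j ∘ lookup-injective xs!)

  joined : Fin v × Fin v → List (Subset v)
  joined (i , j) with i Finₚ.≟ j
  ... | yes _   = []
  ... | no  i≢j = [ blockSubset (proj₁ (joining i j i≢j)) ]

  joined-self : ∀ {i j} → i ≢ j → ∃ λ b → IsBlock b × at i ∈ b × at j ∈ b × blockSubset b ∈ joined (i , j)
  joined-self {i} {j} i≢j with i Finₚ.≟ j
  ... | yes i≡j = contradiction i≡j i≢j
  ... | no  i≢j = let (b , B , i∈b , j∈b) = joining i j i≢j in b , B , i∈b , j∈b , here refl

  joined-block : ∀ p {S} → S ∈ joined p → ∃ λ b → IsBlock b × S ≡ blockSubset b
  joined-block (i , j) S∈ with i Finₚ.≟ j
  joined-block (i , j) (here S≡) | no i≢j = let (b , B , _) = joining i j i≢j in b , B , S≡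

  pairs : List (Fin v × Fin v)
  pairs = cartesianProduct (allFin v) (allFin v)

  _≟ₛ_ : DecidableEquality (Subset v)
  _≟ₛ_ = Vecₚ.≡-dec Boolₚ._≟_

  subsets : List (Subset v)
  -- A block arises once from each ordered pair of its points, while `cover` demands a unique index.
  subsets = deduplicate _≟ₛ_ (concatMap joined pairs)

  subsets-block : ∀ {S} → S ∈ subsets → ∃ λ b → IsBlock b × S ≡ blockSubset b
  subsets-block S∈ =
    let (p , _ , S∈p) = find (Memₚ.∈-concatMap⁻ joined {xs = pairs} (Memₚ.∈-deduplicate⁻ _≟ₛ_ (concatMap joined pairs) S∈))
    in joined-block p S∈p

  block∈subsets : ∀ {i j b} → i ≢ j → IsBlock b → at i ∈ b → at j ∈ b → blockSubset b ∈ subsets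
  block∈subsets {i} {j} i≢j B i∈b j∈b = Memₚ.∈-deduplicate⁺ _≟ₛ_ (Memₚ.∈-concatMap⁺ joined (lose ij∈
    (subst (λ c → blockSubset c ∈ joined (i , j)) c≡b ∈joined)))
    where
    ij∈ : (i , j) ∈ pairs
    ij∈ = Memₚ.∈-cartesianProduct⁺ (Memₚ.∈-allFin i) (Memₚ.∈-allFin j)
    self = joined-self i≢j
    ∈joined = proj₂ (proj₂ (proj₂ (proj₂ self)))
    c≡b = meet (proj₁ (proj₂ self)) B (i≢j ∘ lookup-injective xs!)
            (proj₁ (proj₂ (proj₂ self))) (proj₁ (proj₂ (proj₂ (proj₂ self)))) i∈b j∈b

  nth-block : ∀ k → ∃ λ b → IsBlock b × lookup subsets k ≡ blockSubset b
  nth-block k = subsets-block (Memₚ.∈-lookup {xs = subsets} k)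

  pbd : PBD345 v
  pbd .nblocks = length subsets
  pbd .block = lookup subsets
  pbd .blockSize k = let (b , B , eq) = nth-block k in
    subst InK (sym (trans (cong ∣_∣ eq) (∣blockSubset∣ B))) (block-size B)
  pbd .cover i j i≢j =
    Any.index S∈ , subst (i ∈ₛ_) S≡ (subset⁺ (_∈? b) i∈b) , subst (j ∈ₛ_) S≡ (subset⁺ (_∈? b) j∈b) , unique
    where
    b = proj₁ (joining i j i≢j)
    B = proj₁ (proj₂ (joining i j i≢j))
    i∈b = proj₁ (proj₂ (proj₂ (joining i j i≢j)))
    j∈b = proj₂ (proj₂ (proj₂ (joining i j i≢j)))
    S∈ = block∈subsets i≢j B i∈b j∈b
    S≡ = sym (∈-index-lookup S∈)
    unique : ∀ k → i ∈ₛ lookup subsets k → j ∈ₛ lookup subsets k → k ≡ Any.index S∈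
    unique k i∈k j∈k = let (c , C , eq) = nth-block k in
      lookup-injective (Uniqueᵈₚ.deduplicate-! _≟ₛ_ (concatMap joined pairs))
        (trans eq (trans (cong blockSubset
          (meet C B (i≢j ∘ lookup-injective xs!)
            (subset⁻ (_∈? c) (subst (i ∈ₛ_) eq i∈k)) (subset⁻ (_∈? c) (subst (j ∈ₛ_) eq j∈k)) i∈b j∈b)) S≡))

  -- The subset cut out by the hull is a flat through the three generators, and the generated flat
  -- lies in every such flat.
  pbd-bound : ∀ {m} → (∀ x y z → x ∈ xs → y ∈ xs → z ∈ xs → Hull x y z m) → ThreeGenBound pbd m
  pbd-bound {m} hulls x y z F gen = ℕₚ.≤-trans (p⊆q⇒∣p∣≤∣q∣ F⊆Y) (ℕₚ.≤-trans (∣subset∣≤ in? covered) cover-size)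
    where
    open Design.Hull (hulls (at x) (at y) (at z) (at∈ x) (at∈ y) (at∈ z))
    Y = subset in?
    flat : IsFlat pbd Y
    flat p q p∈Y q∈Y p≢q =
      let (k , p∈k , q∈k , _) = pbd .cover p q p≢q
          (b , B , eq) = nth-block k
      in k , p∈k , q∈k , λ {r} r∈k → subset⁺ in? (closed B (p≢q ∘ lookup-injective xs!)
           (subset⁻ (_∈? b) (subst (p ∈ₛ_) eq p∈k)) (subset⁻ (_∈? b) (subst (q ∈ₛ_) eq q∈k))
           (subset⁻ in? p∈Y) (subset⁻ in? q∈Y) (subset⁻ (_∈? b) (subst (r ∈ₛ_) eq r∈k)))
    generators⊆Y : ⁅ x ⁆ ∪ ⁅ y ⁆ ∪ ⁅ z ⁆ ⊆ₛ Y
    generators⊆Y p∈ with x∈p∪q⁻ ⁅ x ⁆ (⁅ y ⁆ ∪ ⁅ z ⁆) p∈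
    ... | inj₁ p∈x rewrite x∈⁅y⁆⇒x≡y x p∈x = subset⁺ in? x-in
    ... | inj₂ p∈yz with x∈p∪q⁻ ⁅ y ⁆ ⁅ z ⁆ p∈yz
    ...   | inj₁ p∈y rewrite x∈⁅y⁆⇒x≡y y p∈y = subset⁺ in? y-in
    ...   | inj₂ p∈z rewrite x∈⁅y⁆⇒x≡y z p∈z = subset⁺ in? z-in
    F⊆Y : F ⊆ₛ Y
    F⊆Y {p} p∈F = Equivalence.to (gen p) p∈F Y flat generators⊆Y

PBDBound : ℕ → ℕ → Set
PBDBound v m = ∃ λ (D : PBD345 v) → ThreeGenBound D m

trivial-bound : ∀ {v m} → v ≤ m → (D : PBD345 v) → ThreeGenBound D m
trivial-bound v≤m D x y z F _ = ℕₚ.≤-trans (∣p∣≤n F) v≤m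

-- The projective spaces PG(n,4)

-- The field of four elements: 2F and 3F are the roots of X² + X + 1.
F : Set
F = Fin 4

infixl 6 _⊕_
infixl 7 _⊗_

_⊕_ : F → F → F
0F ⊕ y  = y
x  ⊕ 0F = x
1F ⊕ 1F = 0F
1F ⊕ 2F = 3F
1F ⊕ 3F = 2F
2F ⊕ 1F = 3F
2F ⊕ 2F = 0F
2F ⊕ 3F = 1F
3F ⊕ 1F = 2F
3F ⊕ 2F = 1F
3F ⊕ 3F = 0F

_⊗_ : F → F → F
0F ⊗ _  = 0F
1F ⊗ y  = y
2F ⊗ 0F = 0F
2F ⊗ 1F = 2F
2F ⊗ 2F = 3F
2F ⊗ 3F = 1F
3F ⊗ 0F = 0F
3F ⊗ 1F = 3F
3F ⊗ 2F = 1F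
3F ⊗ 3F = 2F

inv : F → F
inv 2F = 3F
inv 3F = 2F
inv x  = x

∀F? : {P : F → Set} → (∀ x → Dec (P x)) → Dec (∀ x → P x)
∀F? = Finₚ.all?

infix 4 _≟_
_≟_ : DecidableEquality F
_≟_ = Finₚ._≟_

-- This and the following field identities are settled by evaluation at all values.
⊕-interchange : ∀ a b c d → (a ⊕ b) ⊕ (c ⊕ d) ≡ (a ⊕ c) ⊕ (b ⊕ d)
⊕-interchange = toWitness {a? = ∀F? λ a → ∀F? λ b → ∀F? λ c → ∀F? λ d → (a ⊕ b) ⊕ (c ⊕ d) ≟ (a ⊕ c) ⊕ (b ⊕ d)} tt

⊗-distribˡ-⊕ : ∀ a b c → a ⊗ (b ⊕ c) ≡ a ⊗ b ⊕ a ⊗ c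
⊗-distribˡ-⊕ = toWitness {a? = ∀F? λ a → ∀F? λ b → ∀F? λ c → a ⊗ (b ⊕ c) ≟ a ⊗ b ⊕ a ⊗ c} tt

⊗-distrib-combination : ∀ α a β b u → α ⊗ (a ⊗ u) ⊕ β ⊗ (b ⊗ u) ≡ (α ⊗ a ⊕ β ⊗ b) ⊗ u
⊗-distrib-combination = toWitness {a? = ∀F? λ α → ∀F? λ a → ∀F? λ β → ∀F? λ b → ∀F? λ u → α ⊗ (a ⊗ u) ⊕ β ⊗ (b ⊗ u) ≟ (α ⊗ a ⊕ β ⊗ b) ⊗ u} tt

⊗-assoc : ∀ a b c → a ⊗ (b ⊗ c) ≡ (a ⊗ b) ⊗ c
⊗-assoc = toWitness {a? = ∀F? λ a → ∀F? λ b → ∀F? λ c → a ⊗ (b ⊗ c) ≟ (a ⊗ b) ⊗ c} tt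

⊗-zeroʳ : ∀ a → a ⊗ 0F ≡ 0F
⊗-zeroʳ = toWitness {a? = ∀F? λ a → a ⊗ 0F ≟ 0F} tt

⊗-identityʳ : ∀ a → a ⊗ 1F ≡ a
⊗-identityʳ = toWitness {a? = ∀F? λ a → a ⊗ 1F ≟ a} tt

⊕-identityʳ : ∀ a → a ⊕ 0F ≡ a
⊕-identityʳ = toWitness {a? = ∀F? λ a → a ⊕ 0F ≟ a} tt

⊗-inverseˡ : ∀ a → a ≢ 0F → inv a ⊗ a ≡ 1F
⊗-inverseˡ = toWitness {a? = ∀F? λ a → ¬? (a ≟ 0F) →-dec inv a ⊗ a ≟ 1F} tt

⊗-cancel-inverse : ∀ a b → a ≢ 0F → a ⊗ (inv a ⊗ b) ≡ b
⊗-cancel-inverse = toWitness {a? = ∀F? λ a → ∀F? λ b → ¬? (a ≟ 0F) →-dec a ⊗ (inv a ⊗ b) ≟ b} tt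

inv-nonzero : ∀ a → a ≢ 0F → inv a ≢ 0F
inv-nonzero = toWitness {a? = ∀F? λ a → ¬? (a ≟ 0F) →-dec ¬? (inv a ≟ 0F)} tt

-- Characteristic two: addition also serves as subtraction throughout.
⊕-cancel : ∀ a b → (b ⊕ a) ⊕ a ≡ b
⊕-cancel = toWitness {a? = ∀F? λ a → ∀F? λ b → (b ⊕ a) ⊕ a ≟ b} tt

-- The affine function t ↦ intercept + t · slope takes the value u at x and w at y.
slope intercept : (x y u w : F) → F
slope x y u w = inv (x ⊕ y) ⊗ (u ⊕ w)
intercept x y u w = u ⊕ x ⊗ slope x y u w

interpolateˡ : ∀ x y u w → intercept x y u w ⊕ x ⊗ slope x y u w ≡ u
interpolateˡ x y u w = ⊕-cancel (x ⊗ slope x y u w) u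

interpolateʳ : ∀ x y u w → x ≢ y → intercept x y u w ⊕ y ⊗ slope x y u w ≡ w
interpolateʳ = toWitness {a? = ∀F? λ x → ∀F? λ y → ∀F? λ u → ∀F? λ w → ¬? (x ≟ y) →-dec intercept x y u w ⊕ y ⊗ slope x y u w ≟ w} tt

slope-unique : ∀ x y a b → x ≢ y → slope x y (a ⊕ x ⊗ b) (a ⊕ y ⊗ b) ≡ b
slope-unique = toWitness {a? = ∀F? λ x → ∀F? λ y → ∀F? λ a → ∀F? λ b → ¬? (x ≟ y) →-dec slope x y (a ⊕ x ⊗ b) (a ⊕ y ⊗ b) ≟ b} tt

-- Homogeneous coordinates with first nonzero entry 1: `fin x` is (1 : x) and `far p` is (0 : p).
-- Each point has one representation, so `_≡_` is equality of points.
data Point : ℕ → Set where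
  fin : ∀ {n} → Vec F n → Point n
  far : ∀ {n} → Point n → Point (suc n)

-- aff d a is the affine line with direction d through the point obtained from a by inserting a zero at the leading position of d.
data Line : ℕ → Set where
  aff : ∀ {n} → Point n → Vec F n → Line (suc n)
  inf : ∀ {n} → Line n → Line (suc n)

-- The base vector, with a zero inserted, plus t times `vec d`. The inserted coordinate becomes t
-- itself, which makes the parametrisation injective.
place : ∀ {n} → Point n → F → Vec F n → Vec F (suc n)
place (fin δ)  t a       = t ∷ Vec.zipWith (λ x y → y ⊕ t ⊗ x) δ a
place (far d) t (x ∷ a) = x ∷ place d t a

infix 30 _at_
_at_ : ∀ {n} → Line n → Fin 5 → Point n
aff d a at zero  = far d
aff d a at suc t = fin (place d t a)
inf ℓ   at i     = far (ℓ at i)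

fin-injective : ∀ {n} {x y : Vec F n} → fin x ≡ fin y → x ≡ y
fin-injective refl = refl

far-injective : ∀ {n} {p q : Point n} → far p ≡ far q → p ≡ q
far-injective refl = refl

-- The coordinate of x at the leading position of d is the parameter t; adding t times d once more
-- recovers the base vector.
place-surjective : ∀ {n} (d : Point n) x → ∃₂ λ t a → place d t a ≡ x
place-surjective (fin δ)  (t ∷ x) = t , Vec.zipWith (λ u w → w ⊕ t ⊗ u) δ x , cong (t ∷_) (cancel δ x)
  where
  cancel : ∀ {n} (δ x : Vec F n) → Vec.zipWith (λ u w → w ⊕ t ⊗ u) δ (Vec.zipWith (λ u w → w ⊕ t ⊗ u) δ x) ≡ x
  cancel []      []      = refl
  cancel (u ∷ δ) (w ∷ x) = cong₂ _∷_ (⊕-cancel (t ⊗ u) w) (cancel δ x)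
place-surjective (far d) (x₀ ∷ x) = let (t , a , eq) = place-surjective d x in t , x₀ ∷ a , cong (x₀ ∷_) eq

place-injective : ∀ {n} (d : Point n) {s t a b} → place d s a ≡ place d t b → s ≡ t × a ≡ b
place-injective (fin δ) {s} {t} {a} {b} eq with Vecₚ.∷-injective eq
... | refl , eq′ = refl , cancel δ a b eq′
  where
  cancel : ∀ {n} (δ a b : Vec F n) → Vec.zipWith (λ u w → w ⊕ t ⊗ u) δ a ≡ Vec.zipWith (λ u w → w ⊕ t ⊗ u) δ b → a ≡ b
  cancel []      []      []      _  = refl
  cancel (u ∷ δ) (x ∷ a) (y ∷ b) eq = let (eq₀ , eq′) = Vecₚ.∷-injective eq in
    cong₂ _∷_ (trans (sym (⊕-cancel (t ⊗ u) x)) (trans (cong (_⊕ t ⊗ u) eq₀) (⊕-cancel (t ⊗ u) y))) (cancel δ a b eq′)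
place-injective (far d) {a = x ∷ a} {y ∷ b} eq with Vecₚ.∷-injective eq
... | refl , eq′ = let (s≡t , a≡b) = place-injective d eq′ in s≡t , cong (x ∷_) a≡b

at-injective : ∀ {n} (ℓ : Line n) {i j} → ℓ at i ≡ ℓ at j → i ≡ j
at-injective (aff d a) {zero}  {zero}  _  = refl
at-injective (aff d a) {suc s} {suc t} eq = cong suc (proj₁ (place-injective d (fin-injective eq)))
at-injective (inf ℓ)   {i}     {j}     eq = at-injective ℓ (far-injective eq)

-- The first coordinate in which x and y differ is the leading position of d; the later coordinates
-- are affine functions of it, found by interpolation.
direction : ∀ {n} (x y : Vec F (suc n)) → x ≢ y → ∃₂ λ d a → ∃₂ λ s t → place d s a ≡ x × place d t a ≡ y
direction (x₀ ∷ x) (y₀ ∷ y) x≢y with x₀ ≟ y₀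
direction {zero}  (x₀ ∷ []) (.x₀ ∷ []) x≢y | yes refl = contradiction refl x≢y
direction {suc n} (x₀ ∷ x)  (.x₀ ∷ y)  x≢y | yes refl =
  let (d , a , s , t , eqˣ , eqʸ) = direction x y (x≢y ∘ cong (x₀ ∷_)) in
  far d , x₀ ∷ a , s , t , cong (x₀ ∷_) eqˣ , cong (x₀ ∷_) eqʸ
direction {n} (x₀ ∷ x) (y₀ ∷ y) x≢y | no x₀≢y₀ =
  fin (Vec.zipWith (slope x₀ y₀) x y) , Vec.zipWith (intercept x₀ y₀) x y , x₀ , y₀ ,
  cong (x₀ ∷_) (left x y) , cong (y₀ ∷_) (right x y)
  where
  left : ∀ {n} (x y : Vec F n) → Vec.zipWith (λ u w → w ⊕ x₀ ⊗ u) (Vec.zipWith (slope x₀ y₀) x y) (Vec.zipWith (intercept x₀ y₀) x y) ≡ x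
  left []      []      = refl
  left (u ∷ x) (w ∷ y) = cong₂ _∷_ (interpolateˡ x₀ y₀ u w) (left x y)
  right : ∀ {n} (x y : Vec F n) → Vec.zipWith (λ u w → w ⊕ y₀ ⊗ u) (Vec.zipWith (slope x₀ y₀) x y) (Vec.zipWith (intercept x₀ y₀) x y) ≡ y
  right []      []      = refl
  right (u ∷ x) (w ∷ y) = cong₂ _∷_ (interpolateʳ x₀ y₀ u w x₀≢y₀) (right x y)

direction-unique : ∀ {n} (d d′ : Point n) {a a′ s s′ t t′} → s ≢ t →
                   place d s a ≡ place d′ s′ a′ → place d t a ≡ place d′ t′ a′ → d ≡ d′
direction-unique (fin δ) (fin δ′) {a} {a′} {s} {_} {t} s≢t eqˢ eqᵗ
  with Vecₚ.∷-injective eqˢ | Vecₚ.∷-injective eqᵗ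
... | refl , eqˢ′ | refl , eqᵗ′ = cong fin (unique δ δ′ a a′ eqˢ′ eqᵗ′)
  where
  unique : ∀ {n} (δ δ′ a a′ : Vec F n) →
           Vec.zipWith (λ u w → w ⊕ s ⊗ u) δ a ≡ Vec.zipWith (λ u w → w ⊕ s ⊗ u) δ′ a′ →
           Vec.zipWith (λ u w → w ⊕ t ⊗ u) δ a ≡ Vec.zipWith (λ u w → w ⊕ t ⊗ u) δ′ a′ → δ ≡ δ′
  unique []      []        []      []        _  _  = refl
  unique (u ∷ δ) (u′ ∷ δ′) (w ∷ a) (w′ ∷ a′) e f =
    let (e₀ , e′) = Vecₚ.∷-injective e
        (f₀ , f′) = Vecₚ.∷-injective f
    in cong₂ _∷_ (trans (sym (slope-unique s t w u s≢t)) (trans (cong₂ (slope s t) e₀ f₀) (slope-unique s t w′ u′ s≢t)))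
                 (unique δ δ′ a a′ e′ f′)
-- Along `fin δ` the first coordinate is the parameter, along `far d′` it is constant.
direction-unique (fin δ)  (far d′) {a′ = x ∷ a′} s≢t eqˢ eqᵗ = contradiction (trans (Vecₚ.∷-injectiveˡ eqˢ) (sym (Vecₚ.∷-injectiveˡ eqᵗ))) s≢t
direction-unique (far d) (fin δ′) {a = x ∷ a} {s = s} {s′} {t} {t′} s≢t eqˢ eqᵗ with Vecₚ.∷-injective eqˢ | Vecₚ.∷-injective eqᵗ
... | refl , eqˢ′ | refl , eqᵗ′ = contradiction (proj₁ (place-injective d (trans eqˢ′ (sym eqᵗ′)))) s≢t
direction-unique (far d) (far d′) {x ∷ a} {x′ ∷ a′} s≢t eqˢ eqᵗ =
  cong far (direction-unique d d′ s≢t (Vecₚ.∷-injectiveʳ eqˢ) (Vecₚ.∷-injectiveʳ eqᵗ))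

through : ∀ {n} (p q : Point n) → p ≢ q → ∃ λ ℓ → ∃₂ λ i j → ℓ at i ≡ p × ℓ at j ≡ q
through {zero}  (fin []) (fin []) p≢q = contradiction refl p≢q
through {suc n} (fin x) (fin y) p≢q =
  let (d , a , s , t , eqˣ , eqʸ) = direction x y (p≢q ∘ cong fin) in
  aff d a , suc s , suc t , cong fin eqˣ , cong fin eqʸ
through (fin x) (far d) p≢q =
  let (t , a , eq) = place-surjective d x in aff d a , suc t , zero , cong fin eq , refl
through (far d) (fin x) p≢q =
  let (t , a , eq) = place-surjective d x in aff d a , zero , suc t , refl , cong fin eq
through (far p) (far q) p≢q =
  let (ℓ , i , j , eqᵖ , eqᑫ) = through p q (p≢q ∘ cong far) in inf ℓ , i , j , cong far eqᵖ , cong far eqᑫ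

line-unique : ∀ {n} (ℓ m : Line n) {i j k l} → i ≢ j → ℓ at i ≡ m at k → ℓ at j ≡ m at l → ℓ ≡ m
line-unique (aff d a) (aff d′ a′) {zero}  {zero}  {k}     {l}     i≢j _ _ = contradiction refl i≢j
line-unique (aff d a) (aff d′ a′) {zero}  {suc t} {zero}  {suc l} i≢j eqⁱ eqʲ with eqⁱ
... | refl = cong (aff d) (proj₂ (place-injective d (fin-injective eqʲ)))
line-unique (aff d a) (aff d′ a′) {suc s} {zero}  {suc k} {zero}  i≢j eqⁱ eqʲ with eqʲ
... | refl = cong (aff d) (proj₂ (place-injective d (fin-injective eqⁱ)))
line-unique (aff d a) (aff d′ a′) {suc s} {suc t} {suc k} {suc l} i≢j eqⁱ eqʲ
  with direction-unique d d′ (i≢j ∘ cong suc) (fin-injective eqⁱ) (fin-injective eqʲ)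
... | refl = cong (aff d) (proj₂ (place-injective d (fin-injective eqⁱ)))
line-unique (aff d a) (inf m) {zero}  {zero}  i≢j _ _ = contradiction refl i≢j
-- An affine line has only one point at infinity, so it cannot share two points with `inf ℓ`.
line-unique (inf ℓ) (aff d a) {k = zero} {zero} i≢j eqⁱ eqʲ = contradiction (at-injective ℓ (far-injective (trans eqⁱ (sym eqʲ)))) i≢j
line-unique (inf ℓ) (inf m) i≢j eqⁱ eqʲ = cong inf (line-unique ℓ m i≢j (far-injective eqⁱ) (far-injective eqʲ))

-- Coordinate vectors and normalisation

vec : ∀ {n} → Point n → Vec F (suc n)
vec (fin x) = 1F ∷ x
vec (far p) = 0F ∷ vec p

infix 4 _≟ᴾ_
_≟ᴾ_ : ∀ {n} → DecidableEquality (Point n)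
fin x ≟ᴾ fin y = map′ (cong fin) fin-injective (Vecₚ.≡-dec _≟_ x y)
fin x ≟ᴾ far q = no λ ()
far p ≟ᴾ fin y = no λ ()
far p ≟ᴾ far q = map′ (cong far) far-injective (p ≟ᴾ q)

vecs : ∀ n → List (Vec F n)
vecs zero    = [ [] ]
vecs (suc n) = cartesianProductWith _∷_ (allFin 4) (vecs n)

∈-vecs : ∀ {n} (x : Vec F n) → x ∈ vecs n
∈-vecs []      = here refl
∈-vecs (c ∷ x) = Memₚ.∈-cartesianProductWith⁺ _∷_ (Memₚ.∈-allFin c) (∈-vecs x)

vecs-! : ∀ n → Unique (vecs n)
vecs-! zero    = [] ∷ []
vecs-! (suc n) = Uniqueₚ.cartesianProductWith⁺ _∷_ Vecₚ.∷-injective (Uniqueₚ.allFin⁺ 4) (vecs-! n)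

points : ∀ n → List (Point n)
points zero    = map fin (vecs zero)
points (suc n) = map fin (vecs (suc n)) ++ map far (points n)

∈-points : ∀ {n} (p : Point n) → p ∈ points n
∈-points {zero}  (fin x) = Memₚ.∈-map⁺ fin (∈-vecs x)
∈-points {suc n} (fin x) = Memₚ.∈-++⁺ˡ (Memₚ.∈-map⁺ fin (∈-vecs x))
∈-points {suc n} (far p) = Memₚ.∈-++⁺ʳ (map fin (vecs (suc n))) (Memₚ.∈-map⁺ far (∈-points p))

points-! : ∀ n → Unique (points n)
points-! zero    = Uniqueₚ.map⁺ fin-injective (vecs-! zero)
points-! (suc n) = Uniqueₚ.++⁺ (Uniqueₚ.map⁺ fin-injective (vecs-! (suc n))) (Uniqueₚ.map⁺ far-injective (points-! n)) disjoint
  where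
  disjoint : ∀ {p} → ¬ (p ∈ map fin (vecs (suc n)) × p ∈ map far (points n))
  disjoint (p∈ , p∈′) with Memₚ.∈-map⁻ fin p∈ | Memₚ.∈-map⁻ far p∈′
  ... | _ , _ , refl | _ , _ , ()

lin : ∀ {n} → F → F → Vec F n → Vec F n → Vec F n
lin α β = Vec.zipWith (λ x y → α ⊗ x ⊕ β ⊗ y)

infixr 7 _·_
_·_ : ∀ {n} → F → Vec F n → Vec F n
α · x = Vec.map (α ⊗_) x

lin-01 : ∀ {n} (x y : Vec F n) → lin 0F 1F x y ≡ y
lin-01 []      []      = refl
lin-01 (_ ∷ x) (_ ∷ y) = cong (_ ∷_) (lin-01 x y)

place-affine : ∀ {n} (d : Point n) t a → place d t a ≡ lin 1F t (place d 0F a) (vec d)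
place-affine (fin δ)  t a       = cong₂ _∷_ (sym (⊗-identityʳ t)) (pointwise δ a)
  where
  pointwise : ∀ {n} (δ a : Vec F n) → Vec.zipWith (λ x y → y ⊕ t ⊗ x) δ a ≡ lin 1F t (Vec.zipWith (λ x y → y ⊕ 0F ⊗ x) δ a) δ
  pointwise []      []      = refl
  pointwise (x ∷ δ) (y ∷ a) = cong₂ _∷_ (cong (_⊕ t ⊗ x) (sym (⊕-identityʳ y))) (pointwise δ a)
place-affine (far d) t (x ∷ a) = cong₂ _∷_ (sym (trans (cong (x ⊕_) (⊗-zeroʳ t)) (⊕-identityʳ x))) (place-affine d t a)

-- The five points of a line as (0 : 1) and (1 : t) in PG(1,4); slot `zero` is the direction of an
-- affine line.
coordinate₁ coordinate₂ : Fin 5 → F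
coordinate₁ zero    = 0F
coordinate₁ (suc _) = 1F
coordinate₂ zero    = 1F
coordinate₂ (suc t) = t

parametrise : ∀ {n} (ℓ : Line n) → ∃₂ λ e f → ∀ i → vec (ℓ at i) ≡ lin (coordinate₁ i) (coordinate₂ i) e f
parametrise (aff d a) = (1F ∷ place d 0F a) , (0F ∷ vec d) , λ where
  zero    → cong (0F ∷_) (sym (lin-01 (place d 0F a) (vec d)))
  (suc t) → cong₂ _∷_ (sym (cong (1F ⊕_) (⊗-zeroʳ t))) (place-affine d t a)
parametrise (inf ℓ) = let (e , f , eq) = parametrise ℓ in
  (0F ∷ e) , (0F ∷ f) , λ i → cong₂ _∷_ (sym (cong₂ _⊕_ (⊗-zeroʳ (coordinate₁ i)) (⊗-zeroʳ (coordinate₂ i)))) (eq i)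

-- Cramer's rule.
solution : (i j k : Fin 5) → F × F
solution i j k = inv (det i j) ⊗ det k j , inv (det i j) ⊗ det i k
  where
  det : Fin 5 → Fin 5 → F
  det a b = coordinate₁ a ⊗ coordinate₂ b ⊕ coordinate₂ a ⊗ coordinate₁ b

collinear : ∀ i j k e f → i ≢ j →
  proj₁ (solution i j k) ⊗ (coordinate₁ i ⊗ e ⊕ coordinate₂ i ⊗ f) ⊕ proj₂ (solution i j k) ⊗ (coordinate₁ j ⊗ e ⊕ coordinate₂ j ⊗ f)
    ≡ coordinate₁ k ⊗ e ⊕ coordinate₂ k ⊗ f
collinear = toWitness {a? = Finₚ.all? λ i → Finₚ.all? λ j → Finₚ.all? λ k → ∀F? λ e → ∀F? λ f → ¬? (i Finₚ.≟ j) →-dec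
  proj₁ (solution i j k) ⊗ (coordinate₁ i ⊗ e ⊕ coordinate₂ i ⊗ f) ⊕ proj₂ (solution i j k) ⊗ (coordinate₁ j ⊗ e ⊕ coordinate₂ j ⊗ f)
    ≟ coordinate₁ k ⊗ e ⊕ coordinate₂ k ⊗ f} tt

-- Distinct slots have independent coordinate pairs, so Cramer's rule expresses any third slot by
-- them. This is what makes planes closed under lines.
at-combination : ∀ {n} (ℓ : Line n) {i j} k → i ≢ j → ∃₂ λ α β → lin α β (vec (ℓ at i)) (vec (ℓ at j)) ≡ vec (ℓ at k)
at-combination ℓ {i} {j} k i≢j =
  let (e , f , eq) = parametrise ℓ
  in proj₁ (solution i j k) , proj₂ (solution i j k) ,
     trans (cong₂ (lin (proj₁ (solution i j k)) (proj₂ (solution i j k))) (eq i) (eq j)) (trans (pointwise e f) (sym (eq k)))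
  where
  pointwise : ∀ {n} (e f : Vec F n) → lin (proj₁ (solution i j k)) (proj₂ (solution i j k))
    (lin (coordinate₁ i) (coordinate₂ i) e f) (lin (coordinate₁ j) (coordinate₂ j) e f) ≡ lin (coordinate₁ k) (coordinate₂ k) e f
  pointwise []      []      = refl
  pointwise (x ∷ e) (y ∷ f) = cong₂ _∷_ (collinear i j k x y i≢j) (pointwise e f)

-- Division by the first nonzero coordinate. The zero vector represents no point and gives
-- `nothing`.
norm : ∀ {n} → Vec F (suc n) → Maybe (Point n)
norm (x₀ ∷ x) with x₀ ≟ 0F
norm {zero}  (x₀ ∷ []) | yes _ = nothing
norm {suc n} (x₀ ∷ x)  | yes _ = Maybe.map far (norm x)
norm         (x₀ ∷ x)  | no _  = just (fin (inv x₀ · x))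

·-assoc : ∀ {n} α β (x : Vec F n) → α · (β · x) ≡ (α ⊗ β) · x
·-assoc α β []      = refl
·-assoc α β (a ∷ x) = cong₂ _∷_ (⊗-assoc α β a) (·-assoc α β x)

·-identityˡ : ∀ {n} (x : Vec F n) → 1F · x ≡ x
·-identityˡ = Vecₚ.map-id

inv-· : ∀ {n} α (x : Vec F n) → α ≢ 0F → inv α · (α · x) ≡ x
inv-· α x α≢0 = trans (·-assoc (inv α) α x) (trans (cong (_· x) (⊗-inverseˡ α α≢0)) (·-identityˡ x))

·-inv : ∀ {n} α (x : Vec F n) → α ≢ 0F → α · (inv α · x) ≡ x
·-inv α []      _   = refl
·-inv α (a ∷ x) α≢0 = cong₂ _∷_ (⊗-cancel-inverse α a α≢0) (·-inv α x α≢0)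

norm-· : ∀ {n} μ (p : Point n) → μ ≢ 0F → norm (μ · vec p) ≡ just p
norm-· μ (fin x) μ≢0 with μ ⊗ 1F ≟ 0F
... | yes eq = contradiction (trans (sym (⊗-identityʳ μ)) eq) μ≢0
... | no  _  = cong (just ∘ fin) (trans (cong (λ ν → inv ν · (μ · x)) (⊗-identityʳ μ)) (inv-· μ x μ≢0))
norm-· μ (far p) μ≢0 with μ ⊗ 0F ≟ 0F
... | yes _ = cong (Maybe.map far) (norm-· μ p μ≢0)
... | no  ≢ = contradiction (⊗-zeroʳ μ) ≢

norm-just : ∀ {n} {p : Point n} x → norm x ≡ just p → ∃ λ μ → μ ≢ 0F × μ · vec p ≡ x
norm-just (x₀ ∷ x) eq with x₀ ≟ 0F
norm-just {zero}  (x₀ ∷ []) () | yes refl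
norm-just {suc n} (x₀ ∷ x) eq | yes refl with norm x in eq′
norm-just {suc n} (x₀ ∷ x) refl | yes refl | just p = let (μ , μ≢0 , eq) = norm-just x eq′ in
  μ , μ≢0 , cong₂ _∷_ (⊗-zeroʳ μ) eq
norm-just (x₀ ∷ x) refl | no x₀≢0 = x₀ , x₀≢0 , cong₂ _∷_ (⊗-identityʳ x₀) (·-inv x₀ x x₀≢0)

norm-nothing : ∀ {n} (x : Vec F (suc n)) → norm x ≡ nothing → x ≡ Vec.replicate (suc n) 0F
norm-nothing (x₀ ∷ x) eq with x₀ ≟ 0F
norm-nothing {zero}  (x₀ ∷ []) eq | yes refl = refl
norm-nothing {suc n} (x₀ ∷ x)  eq | yes refl with norm x in eq′
... | nothing = cong (0F ∷_) (norm-nothing x eq′)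

norm-0 : ∀ n → norm (Vec.replicate (suc n) 0F) ≡ nothing
norm-0 zero    = refl
norm-0 (suc n) = cong (Maybe.map far) (norm-0 n)

norm-vec : ∀ {n} (p : Point n) → norm (vec p) ≡ just p
norm-vec p = trans (cong norm (sym (·-identityˡ (vec p)))) (norm-· 1F p λ ())

-- Planes spanned by three points

dot : Vec F 3 → F → F → F → F
dot (a ∷ b ∷ c ∷ []) x y z = (a ⊗ x ⊕ b ⊗ y) ⊕ c ⊗ z

-- Eleven field elements occur, too many to evaluate all cases, so the identity is derived from the
-- smaller ones.
dot-linear : ∀ α β c d x y z → α ⊗ dot c x y z ⊕ β ⊗ dot d x y z ≡ dot (lin α β c d) x y z
dot-linear α β (a ∷ b ∷ c ∷ []) (a′ ∷ b′ ∷ c′ ∷ []) x y z = begin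
  α ⊗ ((a ⊗ x ⊕ b ⊗ y) ⊕ c ⊗ z) ⊕ β ⊗ ((a′ ⊗ x ⊕ b′ ⊗ y) ⊕ c′ ⊗ z)
    ≡⟨ cong₂ _⊕_ (expand α a b c) (expand β a′ b′ c′) ⟩
  (α ⊗ (a ⊗ x) ⊕ α ⊗ (b ⊗ y)) ⊕ α ⊗ (c ⊗ z) ⊕ ((β ⊗ (a′ ⊗ x) ⊕ β ⊗ (b′ ⊗ y)) ⊕ β ⊗ (c′ ⊗ z))
    ≡⟨ ⊕-interchange (α ⊗ (a ⊗ x) ⊕ α ⊗ (b ⊗ y)) (α ⊗ (c ⊗ z)) (β ⊗ (a′ ⊗ x) ⊕ β ⊗ (b′ ⊗ y)) (β ⊗ (c′ ⊗ z)) ⟩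
  (α ⊗ (a ⊗ x) ⊕ α ⊗ (b ⊗ y)) ⊕ (β ⊗ (a′ ⊗ x) ⊕ β ⊗ (b′ ⊗ y)) ⊕ (α ⊗ (c ⊗ z) ⊕ β ⊗ (c′ ⊗ z))
    ≡⟨ cong₂ _⊕_ (⊕-interchange (α ⊗ (a ⊗ x)) (α ⊗ (b ⊗ y)) (β ⊗ (a′ ⊗ x)) (β ⊗ (b′ ⊗ y))) (⊗-distrib-combination α c β c′ z) ⟩
  (α ⊗ (a ⊗ x) ⊕ β ⊗ (a′ ⊗ x)) ⊕ (α ⊗ (b ⊗ y) ⊕ β ⊗ (b′ ⊗ y)) ⊕ (α ⊗ c ⊕ β ⊗ c′) ⊗ z
    ≡⟨ cong (_⊕ (α ⊗ c ⊕ β ⊗ c′) ⊗ z) (cong₂ _⊕_ (⊗-distrib-combination α a β a′ x) (⊗-distrib-combination α b β b′ y)) ⟩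
  ((α ⊗ a ⊕ β ⊗ a′) ⊗ x ⊕ (α ⊗ b ⊕ β ⊗ b′) ⊗ y) ⊕ (α ⊗ c ⊕ β ⊗ c′) ⊗ z ∎
  where
  open ≡-Reasoning
  expand : ∀ γ a b c → γ ⊗ ((a ⊗ x ⊕ b ⊗ y) ⊕ c ⊗ z) ≡ (γ ⊗ (a ⊗ x) ⊕ γ ⊗ (b ⊗ y)) ⊕ γ ⊗ (c ⊗ z)
  expand γ a b c = trans (⊗-distribˡ-⊕ γ (a ⊗ x ⊕ b ⊗ y) (c ⊗ z)) (cong (_⊕ γ ⊗ (c ⊗ z)) (⊗-distribˡ-⊕ γ (a ⊗ x) (b ⊗ y)))

∈-mapMaybe⁺ : ∀ {A B : Set} (f : A → Maybe B) {xs x y} → x ∈ xs → f x ≡ just y → y ∈ mapMaybe f xs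
∈-mapMaybe⁺ f {x ∷ xs} (here refl) eq rewrite eq = here refl
∈-mapMaybe⁺ f {x ∷ xs} (there x∈)  eq with f x
... | just _  = there (∈-mapMaybe⁺ f x∈ eq)
... | nothing = ∈-mapMaybe⁺ f x∈ eq

∈-mapMaybe⁻ : ∀ {A B : Set} (f : A → Maybe B) {xs y} → y ∈ mapMaybe f xs → ∃ λ x → x ∈ xs × f x ≡ just y
∈-mapMaybe⁻ f {x ∷ xs} y∈ with f x in eq
∈-mapMaybe⁻ f {x ∷ xs} (here refl) | just _ = x , here refl , eq
∈-mapMaybe⁻ f {x ∷ xs} (there y∈)  | just _ = let (z , z∈ , eq′) = ∈-mapMaybe⁻ f y∈ in z , there z∈ , eq′
∈-mapMaybe⁻ f {x ∷ xs} y∈ | nothing = let (z , z∈ , eq′) = ∈-mapMaybe⁻ f y∈ in z , there z∈ , eq′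

module Plane {n} (p q r : Point n) where
  comb : ∀ {m} → Vec F 3 → Vec F m → Vec F m → Vec F m → Vec F m
  comb c []      []      []      = []
  comb c (x ∷ u) (y ∷ v) (z ∷ w) = dot c x y z ∷ comb c u v w

  span : Vec F 3 → Vec F (suc n)
  span c = comb c (vec p) (vec q) (vec r)

  span-linear : ∀ α β c d → lin α β (span c) (span d) ≡ span (lin α β c d)
  span-linear α β c d = go (vec p) (vec q) (vec r)
    where
    go : ∀ {m} (u v w : Vec F m) → lin α β (comb c u v w) (comb d u v w) ≡ comb (lin α β c d) u v w
    go []      []      []      = refl
    go (x ∷ u) (y ∷ v) (z ∷ w) = cong₂ _∷_ (dot-linear α β c d x y z) (go u v w)

  lin-· : ∀ {m} α (x : Vec F m) → lin α 0F x x ≡ α · x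
  lin-· α []      = refl
  lin-· α (a ∷ x) = cong₂ _∷_ (⊕-identityʳ (α ⊗ a)) (lin-· α x)

  span-· : ∀ α c → α · span c ≡ span (α · c)
  span-· α c = trans (sym (lin-· α (span c))) (trans (span-linear α 0F c c) (cong span (lin-· α c)))

  span-0 : span (Vec.replicate 3 0F) ≡ Vec.replicate (suc n) 0F
  span-0 = go (vec p) (vec q) (vec r)
    where
    go : ∀ {m} (u v w : Vec F m) → comb (Vec.replicate 3 0F) u v w ≡ Vec.replicate m 0F
    go []      []      []      = refl
    go (x ∷ u) (y ∷ v) (z ∷ w) = cong (0F ∷_) (go u v w)

  InSpan : Point n → Set
  InSpan s = ∃ λ c → span c ≡ vec s

  -- The coefficient vectors are taken up to scalars, hence from the 21 points of PG(2,4). For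
  -- dependent p, q, r some combinations vanish or coincide, so 21 remains an upper bound.
  plane : List (Point n)
  plane = mapMaybe (norm ∘ span ∘ vec) (points 2)

  length-plane : length plane ≤ 21
  length-plane = Listₚ.length-mapMaybe (norm ∘ span ∘ vec) (points 2)

  plane⁻ : ∀ {s} → s ∈ plane → InSpan s
  plane⁻ {s} s∈ =
    let (c , _ , eq) = ∈-mapMaybe⁻ (norm ∘ span ∘ vec) {xs = points 2} s∈
        (μ , μ≢0 , eq′) = norm-just (span (vec c)) eq
    in inv μ · vec c , trans (sym (span-· (inv μ) (vec c))) (trans (cong (inv μ ·_) (sym eq′)) (inv-· μ (vec s) μ≢0))

  plane⁺ : ∀ {s} → InSpan s → s ∈ plane
  plane⁺ {s} (c , eq) with norm c in eqᶜ
  -- Zero coefficients would make `vec s` the zero vector, but it normalises to s.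
  ... | nothing = contradiction (trans (sym (norm-vec s)) (trans (cong norm (sym eq))
                    (trans (cong (norm ∘ span) (norm-nothing c eqᶜ)) (trans (cong norm span-0) (norm-0 n))))) λ ()
  ... | just d  = let (μ , μ≢0 , eq′) = norm-just c eqᶜ in
    ∈-mapMaybe⁺ (norm ∘ span ∘ vec) {xs = points 2} (∈-points d) (begin
      norm (span (vec d))                    ≡⟨ cong norm (inv-· μ (span (vec d)) μ≢0) ⟨
      norm (inv μ · (μ · span (vec d)))      ≡⟨ cong (λ x → norm (inv μ · x)) (span-· μ (vec d)) ⟩
      norm (inv μ · span (μ · vec d))        ≡⟨ cong (λ x → norm (inv μ · span x)) eq′ ⟩
      norm (inv μ · span c)                  ≡⟨ cong (λ x → norm (inv μ · x)) eq ⟩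
      norm (inv μ · vec s)                   ≡⟨ norm-· (inv μ) s (inv-nonzero μ μ≢0) ⟩
      just s                                 ∎)
    where open ≡-Reasoning

  plane-closed : ∀ ℓ {i j} k → i ≢ j → ℓ at i ∈ plane → ℓ at j ∈ plane → ℓ at k ∈ plane
  plane-closed ℓ k i≢j i∈ j∈ =
    let (c , eqᵢ) = plane⁻ i∈
        (d , eqⱼ) = plane⁻ j∈
        (α , β , eq) = at-combination ℓ k i≢j
    in plane⁺ (lin α β c d , trans (sym (span-linear α β c d)) (trans (cong₂ (lin α β) eqᵢ eqⱼ) eq))

  p∈plane : p ∈ plane
  p∈plane = plane⁺ ((1F ∷ 0F ∷ 0F ∷ []) , go (vec p) (vec q) (vec r))
    where
    go : ∀ {m} (u v w : Vec F m) → comb (1F ∷ 0F ∷ 0F ∷ []) u v w ≡ u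
    go []      []      []      = refl
    go (x ∷ u) (y ∷ v) (z ∷ w) = cong₂ _∷_ (trans (⊕-identityʳ (x ⊕ 0F)) (⊕-identityʳ x)) (go u v w)

  q∈plane : q ∈ plane
  q∈plane = plane⁺ ((0F ∷ 1F ∷ 0F ∷ []) , go (vec p) (vec q) (vec r))
    where
    go : ∀ {m} (u v w : Vec F m) → comb (0F ∷ 1F ∷ 0F ∷ []) u v w ≡ v
    go []      []      []      = refl
    go (x ∷ u) (y ∷ v) (z ∷ w) = cong₂ _∷_ (⊕-identityʳ y) (go u v w)

  r∈plane : r ∈ plane
  r∈plane = plane⁺ ((0F ∷ 0F ∷ 1F ∷ []) , go (vec p) (vec q) (vec r))
    where
    go : ∀ {m} (u v w : Vec F m) → comb (0F ∷ 0F ∷ 1F ∷ []) u v w ≡ w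
    go []      []      []      = refl
    go (x ∷ u) (y ∷ v) (z ∷ w) = cong (z ∷_) (go u v w)

-- Weighted projective spaces

-- Groups may be empty. They are kept out of `blocks`, since a group is shared by all lines through
-- its point and must become a block only once.
record GDD (W : Fin 5 → ℕ) : Set where
  field
    blocks : List (List (Fin 5 × ℕ))
    size : ∀ {b} → b ∈ blocks → InK (length b)
    valid : ∀ {b i k} → b ∈ blocks → (i , k) ∈ b → k < W i
    transversal : ∀ {b} → b ∈ blocks → AllPairs (λ x y → proj₁ x ≢ proj₁ y) b
    join : ∀ {i j k l} → i ≢ j → k < W i → l < W j → ∃ λ b → b ∈ blocks × (i , k) ∈ b × (j , l) ∈ b
    meet : ∀ {b c x y} → proj₁ x ≢ proj₁ y → b ∈ blocks → c ∈ blocks → x ∈ b → y ∈ b → x ∈ c → y ∈ c → b ≡ c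

-- Ingredients are indexed by vectors of weights, whose lookup agrees with the weights on a line
-- only pointwise.
GDD-cong : ∀ {W W′} → (∀ i → W i ≡ W′ i) → GDD W → GDD W′
GDD-cong eq G = record
  { blocks = blocks
  ; size = size
  ; valid = λ {_} {i} b∈ x∈ → subst (_ <_) (eq i) (valid b∈ x∈)
  ; transversal = transversal
  ; join = λ {i} {j} i≢j k< l< → join i≢j (subst (_ <_) (sym (eq i)) k<) (subst (_ <_) (sym (eq j)) l<)
  ; meet = meet
  }
  where open GDD G

AllPairs-distinct : ∀ {A : Set} {R : A → A → Set} {xs x y} → AllPairs R xs → x ∈ xs → y ∈ xs → x ≢ y → R x y ⊎ R y x
AllPairs-distinct (_ ∷ _)  (here refl) (here refl) x≢y = contradiction refl x≢y
AllPairs-distinct (r ∷ _)  (here refl) (there y∈)  _   = inj₁ (All.lookup r y∈)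
AllPairs-distinct (r ∷ _)  (there x∈)  (here refl) _   = inj₂ (All.lookup r x∈)
AllPairs-distinct (_ ∷ rs) (there x∈)  (there y∈)  x≢y = AllPairs-distinct rs x∈ y∈ x≢y

total : ∀ {n} → (Point n → ℕ) → ℕ
total {n} w = sum (map w (points n))

-- Wilson's fundamental construction.
module Weighted {n} (w : Point n → ℕ) (fill : ∀ p → 2 ≤ w p → InK (w p)) (gdd : ∀ ℓ → GDD (λ i → w (ℓ at i))) where
  copies : Point n → List (Point n × ℕ)
  copies p = map (p ,_) (upTo (w p))

  elements : List (Point n × ℕ)
  elements = concatMap copies (points n)

  copies⁻ : ∀ {p x} → x ∈ copies p → proj₁ x ≡ p × proj₂ x < w p
  copies⁻ {p} x∈ with Memₚ.∈-map⁻ (p ,_) x∈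
  ... | k , k∈ , refl = refl , Memₚ.∈-upTo⁻ k∈

  copies⁺ : ∀ {p k} → k < w p → (p , k) ∈ copies p
  copies⁺ {p} k< = Memₚ.∈-map⁺ (p ,_) (Memₚ.∈-upTo⁺ k<)

  elements⁺ : ∀ {p k} → k < w p → (p , k) ∈ elements
  elements⁺ {p} k< = Memₚ.∈-concatMap⁺ copies (lose (∈-points p) (copies⁺ k<))

  elements⁻ : ∀ {p k} → (p , k) ∈ elements → k < w p
  elements⁻ x∈ with find (Memₚ.∈-concatMap⁻ copies {xs = points n} x∈)
  ... | q , _ , x∈q with copies⁻ x∈q
  ...   | refl , k< = k<

  copies-! : ∀ p → Unique (copies p)
  copies-! p = Uniqueₚ.map⁺ (λ { refl → refl }) (Uniqueₚ.upTo⁺ (w p))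

  elements-! : Unique elements
  elements-! = Uniqueₚ.concat⁺ (Allₚ.map⁺ (All.universal copies-! (points n)))
    (AllPairsₚ.map⁺ (AllPairs.map (λ p≢q → λ { (x∈p , x∈q) → p≢q (trans (sym (proj₁ (copies⁻ x∈p))) (proj₁ (copies⁻ x∈q))) }) (points-! n)))

  length-elements : length elements ≡ total w
  length-elements = go (points n)
    where
    go : ∀ ps → length (concatMap copies ps) ≡ sum (map w ps)
    go []       = refl
    go (p ∷ ps) = trans (Listₚ.length-++ (copies p))
      (cong₂ _+_ (trans (Listₚ.length-map (p ,_) (upTo (w p))) (Listₚ.length-upTo (w p))) (go ps))

  onLine : Line n → Fin 5 × ℕ → Point n × ℕ
  onLine ℓ (i , k) = ℓ at i , k

  onLine-injective : ∀ ℓ {x y} → onLine ℓ x ≡ onLine ℓ y → x ≡ y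
  onLine-injective ℓ eq with at-injective ℓ (proj₁ (Productₚ.,-injective eq)) | proj₂ (Productₚ.,-injective eq)
  ... | refl | refl = refl

  -- A group of size 0 or 1 contains no pair and has no admissible size, hence the condition in
  -- `group`.
  data IsBlock : List (Point n × ℕ) → Set where
    group : ∀ p → 2 ≤ w p → IsBlock (copies p)
    line  : ∀ ℓ b → b ∈ GDD.blocks (gdd ℓ) → IsBlock (map (onLine ℓ) b)

  onLine⁻ : ∀ ℓ {b x} → x ∈ map (onLine ℓ) b → ∃₂ λ i k → x ≡ (ℓ at i , k) × (i , k) ∈ b
  onLine⁻ ℓ x∈ with Memₚ.∈-map⁻ (onLine ℓ) x∈
  ... | (i , k) , ik∈ , eq = i , k , eq , ik∈

  transversal-slots : ∀ ℓ {b i j k l} → b ∈ GDD.blocks (gdd ℓ) → (i , k) ∈ b → (j , l) ∈ b → (i , k) ≢ (j , l) → i ≢ j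
  transversal-slots ℓ b∈ x∈ y∈ x≢y with AllPairs-distinct (GDD.transversal (gdd ℓ) b∈) x∈ y∈ x≢y
  ... | inj₁ i≢j = i≢j
  ... | inj₂ j≢i = j≢i ∘ sym

  line-slots : ∀ ℓ {b x y} → b ∈ GDD.blocks (gdd ℓ) → x ≢ y → x ∈ map (onLine ℓ) b → y ∈ map (onLine ℓ) b →
               ∃₂ λ i k → ∃₂ λ j l → i ≢ j × x ≡ (ℓ at i , k) × y ≡ (ℓ at j , l) × (i , k) ∈ b × (j , l) ∈ b
  line-slots ℓ b∈ x≢y x∈ y∈ with onLine⁻ ℓ x∈ | onLine⁻ ℓ y∈
  ... | i , k , refl , x∈b | j , l , refl , y∈b =
    i , k , j , l , transversal-slots ℓ b∈ x∈b y∈b (x≢y ∘ cong (onLine ℓ)) , refl , refl , x∈b , y∈b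

  join : ∀ {x y} → x ∈ elements → y ∈ elements → x ≢ y → ∃ λ b → IsBlock b × x ∈ b × y ∈ b
  join {p , k} {q , l} x∈ y∈ x≢y with p ≟ᴾ q
  ... | yes refl = copies p , group p (two (elements⁻ x∈) (elements⁻ y∈) (x≢y ∘ cong (p ,_))) , copies⁺ (elements⁻ x∈) , copies⁺ (elements⁻ y∈)
    where
    two : ∀ {k l m} → k < m → l < m → k ≢ l → 2 ≤ m
    two {zero}  {zero}  _         _         k≢l = contradiction refl k≢l
    two {zero}  {suc l} _         (s≤s l<m) _   = s≤s (ℕₚ.≤-trans (s≤s z≤n) l<m)
    two {suc k}         (s≤s k<m) _         _   = s≤s (ℕₚ.≤-trans (s≤s z≤n) k<m)
  ... | no p≢q with through p q p≢q
  ...   | ℓ , i , j , refl , refl with GDD.join (gdd ℓ) (p≢q ∘ cong (ℓ at_)) (elements⁻ x∈) (elements⁻ y∈)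
  ...     | b , b∈ , x∈b , y∈b = map (onLine ℓ) b , line ℓ b b∈ , Memₚ.∈-map⁺ (onLine ℓ) x∈b , Memₚ.∈-map⁺ (onLine ℓ) y∈b

  group∩line : ∀ {p ℓ b x y} → b ∈ GDD.blocks (gdd ℓ) → x ≢ y → x ∈ copies p → y ∈ copies p →
               x ∈ map (onLine ℓ) b → y ∈ map (onLine ℓ) b → ⊥
  group∩line {ℓ = ℓ} b∈ x≢y x∈p y∈p x∈b y∈b with line-slots ℓ b∈ x≢y x∈b y∈b
  ... | i , k , j , l , i≢j , refl , refl , _ = i≢j (at-injective ℓ (trans (proj₁ (copies⁻ x∈p)) (sym (proj₁ (copies⁻ y∈p)))))

  meet : ∀ {b c x y} → IsBlock b → IsBlock c → x ≢ y → x ∈ b → y ∈ b → x ∈ c → y ∈ c → b ≡ c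
  meet (group p _)   (group q _)   x≢y x∈p y∈p x∈q y∈q = cong copies (trans (sym (proj₁ (copies⁻ x∈p))) (proj₁ (copies⁻ x∈q)))
  meet (group p _)   (line ℓ b b∈) x≢y x∈p y∈p x∈b y∈b = ⊥-elim (group∩line b∈ x≢y x∈p y∈p x∈b y∈b)
  meet (line ℓ b b∈) (group p _)   x≢y x∈b y∈b x∈p y∈p = ⊥-elim (group∩line b∈ x≢y x∈p y∈p x∈b y∈b)
  meet (line ℓ b b∈) (line m c c∈) x≢y x∈b y∈b x∈c y∈c
    with line-slots ℓ b∈ x≢y x∈b y∈b | line-slots m c∈ x≢y x∈c y∈c
  ... | i , k , j , l , i≢j , refl , refl , ik∈b , jl∈b | i′ , k′ , j′ , l′ , _ , eqˣ , eqʸ , ik∈c , jl∈c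
    -- The two elements lie over different points; these determine the line, and the design on it
    -- determines the block.
    with line-unique ℓ m i≢j (proj₁ (Productₚ.,-injective eqˣ)) (proj₁ (Productₚ.,-injective eqʸ))
  ... | refl with onLine-injective ℓ eqˣ | onLine-injective ℓ eqʸ
  ... | refl | refl = cong (map (onLine ℓ)) (GDD.meet (gdd ℓ) i≢j b∈ c∈ ik∈b jl∈b ik∈c jl∈c)

  design : Design elements
  design .Design.IsBlock = IsBlock
  design .Design.block-⊆ (group p _) x∈ with copies⁻ x∈
  ... | refl , k< = elements⁺ k<
  design .Design.block-⊆ (line ℓ b b∈) x∈ with onLine⁻ ℓ x∈
  ... | i , k , refl , ik∈ = elements⁺ (GDD.valid (gdd ℓ) b∈ ik∈)
  design .Design.block-! (group p _) = copies-! p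
  design .Design.block-! (line ℓ b b∈) = Uniqueₚ.map⁺ (onLine-injective ℓ) (AllPairs.map (λ ≢ eq → ≢ (cong proj₁ eq)) (GDD.transversal (gdd ℓ) b∈))
  design .Design.block-size (group p 2≤w) = subst InK (sym (trans (Listₚ.length-map (p ,_) (upTo (w p))) (Listₚ.length-upTo (w p)))) (fill p 2≤w)
  design .Design.block-size (line ℓ b b∈) = subst InK (sym (Listₚ.length-map (onLine ℓ) b)) (GDD.size (gdd ℓ) b∈)
  design .Design.join = join
  design .Design.meet = meet

  module _ (c : ℕ) (extra : List (Point n × ℕ)) (bounded : ∀ p k → k < w p → k < c ⊎ (p , k) ∈ extra) where
    -- The hull consists of all elements over the plane spanned by the three underlying points.
    -- Apart from `extra`, at most c of them lie over each of its at most 21 points.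
    planeHull : ∀ x y z → Design.Hull design x y z (21 * c + length extra)
    planeHull (p , _) (q , _) (r , _) = record
      { In = λ x → proj₁ x ∈ plane
      ; in? = λ x → proj₁ x ∈? plane
      ; x-in = p∈plane
      ; y-in = q∈plane
      ; z-in = r∈plane
      ; closed = closed
      ; cover = cartesianProduct plane (upTo c) ++ extra
      ; covered = λ {(s , k)} s∈ s∈plane → case bounded s k (elements⁻ s∈) of λ where
          (inj₁ k<c)  → Memₚ.∈-++⁺ˡ (Memₚ.∈-cartesianProduct⁺ s∈plane (Memₚ.∈-upTo⁺ k<c))
          (inj₂ sk∈E) → Memₚ.∈-++⁺ʳ (cartesianProduct plane (upTo c)) sk∈E
      ; cover-size = begin
          length (cartesianProduct plane (upTo c) ++ extra)        ≡⟨ Listₚ.length-++ (cartesianProduct plane (upTo c)) ⟩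
          length (cartesianProduct plane (upTo c)) + length extra  ≡⟨ cong (_+ length extra) (length-cartesianProduct plane (upTo c)) ⟩
          length plane * length (upTo c) + length extra            ≡⟨ cong (λ m → length plane * m + length extra) (Listₚ.length-upTo c) ⟩
          length plane * c + length extra                          ≤⟨ ℕₚ.+-monoˡ-≤ (length extra) (ℕₚ.*-monoˡ-≤ c length-plane) ⟩
          21 * c + length extra                                    ∎
      }
      where
      open Plane p q r
      open DecMembership (_≟ᴾ_ {n}) using (_∈?_)
      open ℕₚ.≤-Reasoning
      length-cartesianProduct : ∀ {A B : Set} (xs : List A) (ys : List B) → length (cartesianProduct xs ys) ≡ length xs * length ys
      length-cartesianProduct []       ys = refl
      length-cartesianProduct (x ∷ xs) ys = trans (Listₚ.length-++ (map (x ,_) ys))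
        (cong₂ _+_ (Listₚ.length-map (x ,_) ys) (length-cartesianProduct xs ys))
      closed : ∀ {b u v} → IsBlock b → u ≢ v → u ∈ b → v ∈ b → proj₁ u ∈ plane → proj₁ v ∈ plane → ∀ {a} → a ∈ b → proj₁ a ∈ plane
      closed (group s _) _ u∈ _ u∈plane _ a∈ = subst (_∈ plane) (trans (proj₁ (copies⁻ u∈)) (sym (proj₁ (copies⁻ a∈)))) u∈plane
      closed (line ℓ b b∈) u≢v u∈ v∈ u∈plane v∈plane a∈ with line-slots ℓ b∈ u≢v u∈ v∈ | onLine⁻ ℓ a∈
      ... | i , _ , j , _ , i≢j , refl , refl , _ | k , _ , refl , _ = plane-closed ℓ k i≢j u∈plane v∈plane

    weighted-PBD : PBDBound (total w) (21 * c + length extra)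
    weighted-PBD = subst (λ v → PBDBound v (21 * c + length extra)) length-elements
      (pbd , pbd-bound λ x y z _ _ _ → planeHull x y z)
      where open ToPBD (Productₚ.≡-dec _≟ᴾ_ ℕₚ._≟_) elements-! design

-- Ingredient designs

∀Bool? : ∀ {P : Bool → Set} → (∀ b → Dec (P b)) → Dec (∀ b → P b)
∀Bool? P? = map′ (λ (pf , pt) → λ { false → pf ; true → pt }) (λ p → p false , p true) (P? false ×-dec P? true)

inK? : ∀ k → Dec (InK k)
inK? k = (k ℕₚ.≟ 3) ⊎-dec ((k ℕₚ.≟ 4) ⊎-dec (k ℕₚ.≟ 5))

-- The fibres of g are the groups of the design; a pairwise balanced design is the case of an injective g.
module Verify {A G : Set} (_≟ᴬ_ : DecidableEquality A) (_≟ᴳ_ : DecidableEquality G) (g : A → G) (xs : List A) where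
  open DecMembership _≟ᴬ_ using (_∈?_)

  BlockOK : List A → Set
  BlockOK b = InK (length b) × All (_∈ xs) b × AllPairs (λ x y → g x ≢ g y) b

  -- Here `bs` stands for the blocks through x, filtered beforehand. The count 1 expresses existence
  -- and uniqueness at once.
  Joined : List (List A) → A → Set
  Joined bs x = All (λ y → g x ≡ g y ⊎ length (filter (y ∈?_) bs) ≡ 1) xs

  Valid : List (List A) → Set
  Valid bs = All BlockOK bs × All (λ x → Joined (filter (x ∈?_) bs) x) xs

  joined? : ∀ bs x → Dec (Joined bs x)
  joined? bs x = All.all? (λ y → (g x ≟ᴳ g y) ⊎-dec (length (filter (y ∈?_) bs) ℕₚ.≟ 1)) xs

  valid? : ∀ bs → Dec (Valid bs)
  valid? bs = All.all? (λ b → inK? (length b) ×-dec (All.all? (_∈? xs) b ×-dec AllPairs.allPairs? (λ x y → ¬? (g x ≟ᴳ g y)) b)) bs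
    ×-dec All.all? (λ x → joined? (filter (x ∈?_) bs) x) xs

  module _ {bs} (valid : Valid bs) where
    size : ∀ {b} → b ∈ bs → InK (length b)
    size b∈ = proj₁ (All.lookup (proj₁ valid) b∈)

    block-⊆ : ∀ {b x} → b ∈ bs → x ∈ b → x ∈ xs
    block-⊆ b∈ x∈ = All.lookup (proj₁ (proj₂ (All.lookup (proj₁ valid) b∈))) x∈

    transversal : ∀ {b} → b ∈ bs → AllPairs (λ x y → g x ≢ g y) b
    transversal b∈ = proj₂ (proj₂ (All.lookup (proj₁ valid) b∈))

    both : A → A → List (List A)
    both x y = filter (y ∈?_) (filter (x ∈?_) bs)

    only : ∀ {x y} → g x ≢ g y → x ∈ xs → y ∈ xs → ∃ λ b → both x y ≡ b ∷ []
    only {x} {y} x≢y x∈ y∈ with All.lookup (All.lookup (proj₂ valid) x∈) y∈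
    ... | inj₁ x≡y = contradiction x≡y x≢y
    ... | inj₂ one = singleton (both x y) one
      where
      singleton : ∀ {A : Set} (xs : List A) → length xs ≡ 1 → ∃ λ a → xs ≡ a ∷ []
      singleton (a ∷ []) _ = a , refl

    join : ∀ {x y} → g x ≢ g y → x ∈ xs → y ∈ xs → ∃ λ b → b ∈ bs × x ∈ b × y ∈ b
    join {x} {y} x≢y x∈ y∈ =
      let (b , eq) = only x≢y x∈ y∈
          (b∈ₓ , y∈b) = Memₚ.∈-filter⁻ (y ∈?_) {xs = filter (x ∈?_) bs} (subst (b ∈_) (sym eq) (here refl))
          (b∈ , x∈b) = Memₚ.∈-filter⁻ (x ∈?_) {xs = bs} b∈ₓ
      in b , b∈ , x∈b , y∈b

    meet : ∀ {b c x y} → g x ≢ g y → b ∈ bs → c ∈ bs → x ∈ b → y ∈ b → x ∈ c → y ∈ c → b ≡ c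
    meet {b} {c} {x} {y} x≢y b∈ c∈ x∈b y∈b x∈c y∈c =
      let (d , eq) = only x≢y (block-⊆ b∈ x∈b) (block-⊆ b∈ y∈b)
      in trans (single (subst (b ∈_) eq (both⁺ b∈ x∈b y∈b))) (sym (single (subst (c ∈_) eq (both⁺ c∈ x∈c y∈c))))
      where
      single : ∀ {A : Set} {a b : A} → a ∈ b ∷ [] → a ≡ b
      single (here eq) = eq
      both⁺ : ∀ {b} → b ∈ bs → x ∈ b → y ∈ b → b ∈ both x y
      both⁺ b∈ x∈ y∈ = Memₚ.∈-filter⁺ (y ∈?_) (Memₚ.∈-filter⁺ (x ∈?_) b∈ x∈) y∈

slots : (Fin 5 → ℕ) → List (Fin 5 × ℕ)
slots W = concatMap (λ i → map (i ,_) (upTo (W i))) (allFin 5)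

∈-slots⁺ : ∀ {W i k} → k < W i → (i , k) ∈ slots W
∈-slots⁺ {W} {i} k< = Memₚ.∈-concatMap⁺ (λ i → map (i ,_) (upTo (W i))) (lose (Memₚ.∈-allFin i) (Memₚ.∈-map⁺ (i ,_) (Memₚ.∈-upTo⁺ k<)))

∈-slots⁻ : ∀ {W i k} → (i , k) ∈ slots W → k < W i
∈-slots⁻ {W} x∈ with find (Memₚ.∈-concatMap⁻ (λ i → map (i ,_) (upTo (W i))) {xs = allFin 5} x∈)
... | j , _ , x∈j with Memₚ.∈-map⁻ (j ,_) x∈j
...   | k , k∈ , refl = Memₚ.∈-upTo⁻ k∈

module VerifyGDD (W : Fin 5 → ℕ) = Verify (Productₚ.≡-dec Finₚ._≟_ ℕₚ._≟_) Finₚ._≟_ proj₁ (slots W)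

valid-GDD : ∀ {W bs} → VerifyGDD.Valid W bs → GDD W
valid-GDD {W} {bs} valid = record
  { blocks = bs
  ; size = size valid
  ; valid = λ b∈ x∈ → ∈-slots⁻ {W} (block-⊆ valid b∈ x∈)
  ; transversal = transversal valid
  ; join = λ i≢j k< l< → join valid i≢j (∈-slots⁺ {W} k<) (∈-slots⁺ {W} l<)
  ; meet = meet valid
  }
  where open VerifyGDD W

module VerifyPBD (v : ℕ) = Verify ℕₚ._≟_ ℕₚ._≟_ id (upTo v)

valid-PBD : ∀ {v bs} → VerifyPBD.Valid v bs → PBD345 v
valid-PBD {v} {bs} valid = subst PBD345 (Listₚ.length-upTo v) pbd
  where
  open VerifyPBD v
  design : Design (upTo v)
  design = record
    { IsBlock = _∈ bs
    ; block-⊆ = λ b∈ x∈ → block-⊆ valid b∈ x∈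
    ; block-! = transversal valid
    ; block-size = size valid
    ; join = λ x∈ y∈ x≢y → join valid x≢y x∈ y∈
    ; meet = λ b∈ c∈ x≢y → meet valid x≢y b∈ c∈
    }
  open ToPBD ℕₚ._≟_ (Uniqueₚ.upTo⁺ v) design using (pbd)

-- Ingredients with groups of sizes 0, 1 and 3

Weight : Set
Weight = Fin 3

val : Weight → ℕ
val 0F = 0
val 1F = 1
val 2F = 3

positions : Vec Weight 5 → Weight → List (Fin 5)
positions ω a = filter (λ i → Vec.lookup ω i Finₚ.≟ a) (allFin 5)

-- The copy c of the j-th group is encoded as 3 j + c, where the groups of size 1 come before those of size 3.
template : ℕ → ℕ → Maybe (List (List ℕ))
template 0 0 = just []
template 1 0 = just []
template 0 1 = just []
template 3 0 = just [ 0 ∷ 3 ∷ 6 ∷ [] ]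
template 4 0 = just [ 0 ∷ 3 ∷ 6 ∷ 9 ∷ [] ]
template 5 0 = just [ 0 ∷ 3 ∷ 6 ∷ 9 ∷ 12 ∷ [] ]
template 4 1 = just
    ( (0 ∷ 3 ∷ 14 ∷ []) ∷ (0 ∷ 6 ∷ 13 ∷ []) ∷ (0 ∷ 9 ∷ 12 ∷ []) ∷ (3 ∷ 6 ∷ 12 ∷ []) ∷ (3 ∷ 9 ∷ 13 ∷ []) ∷ (6 ∷ 9 ∷ 14 ∷ [])
    ∷ [])
template 3 2 = just
    ( (0 ∷ 3 ∷ 6 ∷ []) ∷ (0 ∷ 9 ∷ 13 ∷ []) ∷ (0 ∷ 10 ∷ 12 ∷ []) ∷ (0 ∷ 11 ∷ 14 ∷ []) ∷ (3 ∷ 9 ∷ 14 ∷ []) ∷ (3 ∷ 10 ∷ 13 ∷ [])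
    ∷ (3 ∷ 11 ∷ 12 ∷ []) ∷ (6 ∷ 9 ∷ 12 ∷ []) ∷ (6 ∷ 10 ∷ 14 ∷ []) ∷ (6 ∷ 11 ∷ 13 ∷ [])
    ∷ [])
template 2 3 = just
    ( (0 ∷ 3 ∷ 8 ∷ 10 ∷ 13 ∷ []) ∷ (0 ∷ 6 ∷ 11 ∷ []) ∷ (0 ∷ 7 ∷ 14 ∷ []) ∷ (0 ∷ 9 ∷ 12 ∷ []) ∷ (3 ∷ 6 ∷ 12 ∷ []) ∷ (3 ∷ 7 ∷ 9 ∷ [])
    ∷ (3 ∷ 11 ∷ 14 ∷ []) ∷ (6 ∷ 9 ∷ 13 ∷ []) ∷ (6 ∷ 10 ∷ 14 ∷ []) ∷ (7 ∷ 10 ∷ 12 ∷ []) ∷ (7 ∷ 11 ∷ 13 ∷ []) ∷ (8 ∷ 9 ∷ 14 ∷ [])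
    ∷ (8 ∷ 11 ∷ 12 ∷ [])
    ∷ [])
template 1 4 = just
    ( (0 ∷ 3 ∷ 9 ∷ []) ∷ (0 ∷ 4 ∷ 14 ∷ []) ∷ (0 ∷ 5 ∷ 6 ∷ []) ∷ (0 ∷ 7 ∷ 11 ∷ []) ∷ (0 ∷ 8 ∷ 13 ∷ []) ∷ (0 ∷ 10 ∷ 12 ∷ [])
    ∷ (3 ∷ 6 ∷ 10 ∷ 13 ∷ []) ∷ (3 ∷ 7 ∷ 12 ∷ []) ∷ (3 ∷ 8 ∷ 11 ∷ 14 ∷ []) ∷ (4 ∷ 6 ∷ 11 ∷ 12 ∷ []) ∷ (4 ∷ 7 ∷ 9 ∷ 13 ∷ []) ∷ (4 ∷ 8 ∷ 10 ∷ [])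
    ∷ (5 ∷ 7 ∷ 10 ∷ 14 ∷ []) ∷ (5 ∷ 8 ∷ 9 ∷ 12 ∷ []) ∷ (5 ∷ 11 ∷ 13 ∷ []) ∷ (6 ∷ 9 ∷ 14 ∷ [])
    ∷ [])
template 0 5 = just
    ( (0 ∷ 3 ∷ 9 ∷ []) ∷ (0 ∷ 4 ∷ 6 ∷ []) ∷ (0 ∷ 5 ∷ 11 ∷ 12 ∷ []) ∷ (0 ∷ 7 ∷ 13 ∷ []) ∷ (0 ∷ 8 ∷ 10 ∷ 14 ∷ []) ∷ (1 ∷ 3 ∷ 8 ∷ [])
    ∷ (1 ∷ 4 ∷ 9 ∷ []) ∷ (1 ∷ 5 ∷ 14 ∷ []) ∷ (1 ∷ 6 ∷ 12 ∷ []) ∷ (1 ∷ 7 ∷ 11 ∷ []) ∷ (1 ∷ 10 ∷ 13 ∷ []) ∷ (2 ∷ 3 ∷ 10 ∷ 12 ∷ [])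
    ∷ (2 ∷ 4 ∷ 13 ∷ []) ∷ (2 ∷ 5 ∷ 7 ∷ []) ∷ (2 ∷ 6 ∷ 9 ∷ 14 ∷ []) ∷ (2 ∷ 8 ∷ 11 ∷ []) ∷ (3 ∷ 6 ∷ 11 ∷ 13 ∷ []) ∷ (3 ∷ 7 ∷ 14 ∷ [])
    ∷ (4 ∷ 7 ∷ 10 ∷ []) ∷ (4 ∷ 8 ∷ 12 ∷ []) ∷ (4 ∷ 11 ∷ 14 ∷ []) ∷ (5 ∷ 6 ∷ 10 ∷ []) ∷ (5 ∷ 8 ∷ 9 ∷ 13 ∷ []) ∷ (7 ∷ 9 ∷ 12 ∷ [])
    ∷ [])
-- The two types with four nonempty groups, not all of size 1, occur on lines through the vertex of
-- a cone.
template 1 3 = just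
    ( (0 ∷ 3 ∷ 7 ∷ 10 ∷ []) ∷ (0 ∷ 4 ∷ 8 ∷ 11 ∷ []) ∷ (0 ∷ 5 ∷ 6 ∷ 9 ∷ []) ∷ (3 ∷ 6 ∷ 11 ∷ []) ∷ (3 ∷ 8 ∷ 9 ∷ []) ∷ (4 ∷ 6 ∷ 10 ∷ [])
    ∷ (4 ∷ 7 ∷ 9 ∷ []) ∷ (5 ∷ 7 ∷ 11 ∷ []) ∷ (5 ∷ 8 ∷ 10 ∷ [])
    ∷ [])
template 0 4 = just
    ( (0 ∷ 3 ∷ 7 ∷ []) ∷ (0 ∷ 4 ∷ 9 ∷ []) ∷ (0 ∷ 5 ∷ 8 ∷ 11 ∷ []) ∷ (0 ∷ 6 ∷ 10 ∷ []) ∷ (1 ∷ 3 ∷ 6 ∷ 9 ∷ []) ∷ (1 ∷ 4 ∷ 8 ∷ [])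
    ∷ (1 ∷ 5 ∷ 10 ∷ []) ∷ (1 ∷ 7 ∷ 11 ∷ []) ∷ (2 ∷ 3 ∷ 11 ∷ []) ∷ (2 ∷ 4 ∷ 7 ∷ 10 ∷ []) ∷ (2 ∷ 5 ∷ 6 ∷ []) ∷ (2 ∷ 8 ∷ 9 ∷ [])
    ∷ (3 ∷ 8 ∷ 10 ∷ []) ∷ (4 ∷ 6 ∷ 11 ∷ []) ∷ (5 ∷ 7 ∷ 9 ∷ [])
    ∷ [])
template _ _ = nothing

nth : List (Fin 5) → ℕ → Fin 5
-- Default value; the codes in the templates stay below three times the number of groups.
nth []       _       = 0F
nth (i ∷ _)  zero    = i
nth (_ ∷ is) (suc j) = nth is j

decode : List (Fin 5) → ℕ → Fin 5 × ℕ
decode is m = nth is (m / 3) , m % 3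

ingredient : Vec Weight 5 → Maybe (List (List ℕ))
ingredient ω = template (length (positions ω 1F)) (length (positions ω 2F))

IngredientOK : Vec Weight 5 → Maybe (List (List ℕ)) → Set
IngredientOK ω nothing   = ⊤
IngredientOK ω (just bs) = VerifyGDD.Valid (val ∘ Vec.lookup ω) (map (map (decode (positions ω 1F ++ positions ω 2F))) bs)

ingredientOK? : ∀ ω t → Dec (IngredientOK ω t)
ingredientOK? ω nothing   = yes tt
ingredientOK? ω (just bs) = VerifyGDD.valid? (val ∘ Vec.lookup ω) (map (map (decode (positions ω 1F ++ positions ω 2F))) bs)

-- One template serves all words with the same numbers of weights 1 and 3; its placement is checked
-- for each of the 243 words.
ingredients-valid : ∀ a b c d e → let ω = a ∷ b ∷ c ∷ d ∷ e ∷ [] in IngredientOK ω (ingredient ω)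
ingredients-valid = toWitness {a? = Finₚ.all? λ a → Finₚ.all? λ b → Finₚ.all? λ c → Finₚ.all? λ d → Finₚ.all? λ e →
  let ω = a ∷ b ∷ c ∷ d ∷ e ∷ [] in ingredientOK? ω (ingredient ω)} tt

Admissible : Vec Weight 5 → Set
Admissible ω = T (Maybe.is-just (ingredient ω))

gdd₁₃ : ∀ ω → Admissible ω → GDD (val ∘ Vec.lookup ω)
gdd₁₃ ω@(a ∷ b ∷ c ∷ d ∷ e ∷ []) ok = go (ingredient ω) ok (ingredients-valid a b c d e)
  where
  go : ∀ t → T (Maybe.is-just t) → IngredientOK ω t → GDD (val ∘ Vec.lookup ω)
  go (just _) _ v = valid-GDD v

-- Ingredients with groups of sizes 4 and 5

val₄₅ : Bool → ℕ
val₄₅ five = if five then 5 else 4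

-- The affine plane of order 5 with some points of the parabola y = x² deleted: the copy k of the group x is the point (x , x² + 1 + k), so k = 4 gives the point of the parabola.
affineBlocks : Vec Bool 5 → List (List (Fin 5 × ℕ))
affineBlocks ω = concatMap (λ a → map (λ b → filter (λ (x , k) → k <? val₄₅ (Vec.lookup ω x))
  (map (λ x → x , (a * toℕ x + b + 4 * (toℕ x * toℕ x + 1)) % 5) (allFin 5))) (upTo 5)) (upTo 5)

-- A line that is not vertical meets the parabola in at most two points, so at least three of its
-- five points survive the deletion.
affineBlocks-valid : ∀ a b c d e → let ω = a ∷ b ∷ c ∷ d ∷ e ∷ [] in VerifyGDD.Valid (val₄₅ ∘ Vec.lookup ω) (affineBlocks ω)
affineBlocks-valid = toWitness {a? = ∀Bool? λ a → ∀Bool? λ b → ∀Bool? λ c → ∀Bool? λ d → ∀Bool? λ e →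
  let ω = a ∷ b ∷ c ∷ d ∷ e ∷ [] in VerifyGDD.valid? (val₄₅ ∘ Vec.lookup ω) (affineBlocks ω)} tt

gdd₄₅ : ∀ ω → GDD (val₄₅ ∘ Vec.lookup ω)
gdd₄₅ ω@(a ∷ b ∷ c ∷ d ∷ e ∷ []) = valid-GDD (affineBlocks-valid a b c d e)

-- Pairwise balanced designs of orders 14 and 30

blocks₁₀ blocks₁₄ blocks₃₀ : List (List ℕ)
blocks₁₀ =
  (0 ∷ 1 ∷ 9 ∷ []) ∷ (0 ∷ 2 ∷ 6 ∷ []) ∷ (0 ∷ 3 ∷ 5 ∷ []) ∷ (0 ∷ 4 ∷ 7 ∷ 8 ∷ []) ∷ (1 ∷ 2 ∷ 4 ∷ []) ∷ (1 ∷ 3 ∷ 6 ∷ 7 ∷ [])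
  ∷ (1 ∷ 5 ∷ 8 ∷ []) ∷ (2 ∷ 3 ∷ 8 ∷ []) ∷ (2 ∷ 5 ∷ 7 ∷ 9 ∷ []) ∷ (3 ∷ 4 ∷ 9 ∷ []) ∷ (4 ∷ 5 ∷ 6 ∷ []) ∷ (6 ∷ 8 ∷ 9 ∷ [])
  ∷ []
blocks₁₄ =
  (0 ∷ 1 ∷ 5 ∷ 6 ∷ []) ∷ (0 ∷ 2 ∷ 3 ∷ 10 ∷ 12 ∷ []) ∷ (0 ∷ 4 ∷ 9 ∷ []) ∷ (0 ∷ 7 ∷ 8 ∷ []) ∷ (0 ∷ 11 ∷ 13 ∷ []) ∷ (1 ∷ 2 ∷ 8 ∷ [])
  ∷ (1 ∷ 3 ∷ 7 ∷ []) ∷ (1 ∷ 4 ∷ 12 ∷ 13 ∷ []) ∷ (1 ∷ 9 ∷ 10 ∷ 11 ∷ []) ∷ (2 ∷ 4 ∷ 6 ∷ []) ∷ (2 ∷ 5 ∷ 11 ∷ []) ∷ (2 ∷ 7 ∷ 9 ∷ 13 ∷ [])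
  ∷ (3 ∷ 4 ∷ 8 ∷ 11 ∷ []) ∷ (3 ∷ 5 ∷ 13 ∷ []) ∷ (3 ∷ 6 ∷ 9 ∷ []) ∷ (4 ∷ 5 ∷ 7 ∷ 10 ∷ []) ∷ (5 ∷ 8 ∷ 9 ∷ 12 ∷ []) ∷ (6 ∷ 7 ∷ 11 ∷ 12 ∷ [])
  ∷ (6 ∷ 8 ∷ 10 ∷ 13 ∷ [])
  ∷ []
-- Copies of the design of order 10 fill the three groups of a transversal design, whose blocks come
-- from the addition table modulo 10.
blocks₃₀ = concatMap (λ i → map (map (10 * i +_)) blocks₁₀) (upTo 3)
  ++ concatMap (λ a → map (λ b → a ∷ 10 + b ∷ 20 + (a + b) % 10 ∷ []) (upTo 10)) (upTo 10)

pbd₁₄ : PBD345 14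
pbd₁₄ = valid-PBD (toWitness {a? = VerifyPBD.valid? 14 blocks₁₄} tt)

pbd₃₀ : PBD345 30
pbd₃₀ = valid-PBD (toWitness {a? = VerifyPBD.valid? 30 blocks₃₀} tt)

-- Sums over projective spaces

sum-map-const : ∀ {A : Set} c (xs : List A) → sum (map (λ _ → c) xs) ≡ length xs * c
sum-map-const c []       = refl
sum-map-const c (_ ∷ xs) = cong (c +_) (sum-map-const c xs)

sumᵛ : ∀ n → (Vec F n → ℕ) → ℕ
sumᵛ n f = sum (map f (vecs n))

sumᵛ-suc : ∀ n f → sumᵛ (suc n) f ≡ sumᵛ n (f ∘ (0F ∷_)) + (sumᵛ n (f ∘ (1F ∷_)) + (sumᵛ n (f ∘ (2F ∷_)) + sumᵛ n (f ∘ (3F ∷_))))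
sumᵛ-suc n f = begin
  sum (map f (vs 0F ++ vs 1F ++ vs 2F ++ vs 3F ++ []))
    ≡⟨ split 0F _ ⟩
  sumᵛ n (f ∘ (0F ∷_)) + sum (map f (vs 1F ++ vs 2F ++ vs 3F ++ []))
    ≡⟨ cong (sumᵛ n (f ∘ (0F ∷_)) +_) (split 1F _) ⟩
  sumᵛ n (f ∘ (0F ∷_)) + (sumᵛ n (f ∘ (1F ∷_)) + sum (map f (vs 2F ++ vs 3F ++ [])))
    ≡⟨ cong (λ s → sumᵛ n (f ∘ (0F ∷_)) + (sumᵛ n (f ∘ (1F ∷_)) + s)) (split 2F _) ⟩
  sumᵛ n (f ∘ (0F ∷_)) + (sumᵛ n (f ∘ (1F ∷_)) + (sumᵛ n (f ∘ (2F ∷_)) + sum (map f (vs 3F ++ []))))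
    ≡⟨ cong (λ s → sumᵛ n (f ∘ (0F ∷_)) + (sumᵛ n (f ∘ (1F ∷_)) + (sumᵛ n (f ∘ (2F ∷_)) + s))) (trans (split 3F []) (ℕₚ.+-identityʳ _)) ⟩
  sumᵛ n (f ∘ (0F ∷_)) + (sumᵛ n (f ∘ (1F ∷_)) + (sumᵛ n (f ∘ (2F ∷_)) + sumᵛ n (f ∘ (3F ∷_)))) ∎
  where
  open ≡-Reasoning
  vs : F → List (Vec F (suc n))
  vs c = map (c ∷_) (vecs n)
  split : ∀ c ys → sum (map f (vs c ++ ys)) ≡ sumᵛ n (f ∘ (c ∷_)) + sum (map f ys)
  split c ys = trans (cong sum (Listₚ.map-++ f (vs c) ys)) (trans (Sumₚ.sum-++ (map f (vs c)) (map f ys))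
    (cong (λ zs → sum zs + sum (map f ys)) (sym (Listₚ.map-∘ {g = f} {f = c ∷_} (vecs n)))))

total-suc : ∀ {n} (w : Point (suc n) → ℕ) → total w ≡ sumᵛ (suc n) (w ∘ fin) + total (w ∘ far)
total-suc {n} w = trans (cong sum (Listₚ.map-++ w (map fin (vecs (suc n))) (map far (points n))))
  (trans (Sumₚ.sum-++ (map w (map fin (vecs (suc n)))) (map w (map far (points n))))
    (cong₂ (λ xs ys → sum xs + sum ys) (sym (Listₚ.map-∘ {g = w} {f = fin} (vecs (suc n)))) (sym (Listₚ.map-∘ {g = w} {f = far} (points n)))))

sumᵛ-1 : ∀ n → sumᵛ n (λ _ → 1) ≡ 4 ^ n
sumᵛ-1 zero    = refl
sumᵛ-1 (suc n) = trans (sumᵛ-suc n (λ _ → 1)) (trans (cong (λ s → s + (s + (s + s))) (sumᵛ-1 n)) (solve 1 (λ s → s :+ (s :+ (s :+ s)) := con 4 :* s) refl (4 ^ n)))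
  where open +-*-Solver

repunit-suc : ∀ n → [ suc n ]₄ ≡ 4 ^ suc n + [ n ]₄
repunit-suc zero    = refl
repunit-suc (suc n) = trans (cong (λ m → 1 + 4 * m) (repunit-suc n))
  (solve 2 (λ p m → con 1 :+ con 4 :* (p :+ m) := con 4 :* p :+ (con 1 :+ con 4 :* m)) refl (4 ^ suc n) [ n ]₄)
  where open +-*-Solver

length-points : ∀ n → length (points n) ≡ [ n ]₄
length-points n = trans (sym (ℕₚ.*-identityʳ (length (points n)))) (trans (sym (sum-map-const 1 (points n))) (go n))
  where
  go : ∀ n → total {n} (λ _ → 1) ≡ [ n ]₄
  go zero    = refl
  go (suc n) = trans (total-suc {n} (λ _ → 1)) (trans (cong₂ _+_ (sumᵛ-1 (suc n)) (go n)) (sym (repunit-suc n)))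

-- Scaling by a nonzero c permutes the four slices by leading coordinate and acts on each of them by
-- scaling again.
sumᵛ-scale : ∀ n {c} f → c ≢ 0F → sumᵛ n (f ∘ (c ·_)) ≡ sumᵛ n f
sumᵛ-scale zero    f c≢0 = refl
sumᵛ-scale (suc n) {c} f c≢0 = trans (sumᵛ-suc n (f ∘ (c ·_))) (trans
  (cong₂ _+_ (slice 0F) (cong₂ _+_ (slice 1F) (cong₂ _+_ (slice 2F) (slice 3F))))
  (trans (permute c c≢0) (sym (sumᵛ-suc n f))))
  where
  slice : ∀ a → sumᵛ n (λ x → f (c · (a ∷ x))) ≡ sumᵛ n (f ∘ (c ⊗ a ∷_))
  slice a = sumᵛ-scale n (f ∘ (c ⊗ a ∷_)) c≢0
  s : F → ℕ
  s a = sumᵛ n (f ∘ (a ∷_))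
  permute : ∀ c → c ≢ 0F → s (c ⊗ 0F) + (s (c ⊗ 1F) + (s (c ⊗ 2F) + s (c ⊗ 3F))) ≡ s 0F + (s 1F + (s 2F + s 3F))
  permute 0F c≢0 = contradiction refl c≢0
  permute 1F _ = refl
  permute 2F _ = solve 4 (λ w x y z → w :+ (y :+ (z :+ x)) := w :+ (x :+ (y :+ z))) refl (s 0F) (s 1F) (s 2F) (s 3F)
    where open +-*-Solver
  permute 3F _ = solve 4 (λ w x y z → w :+ (z :+ (x :+ y)) := w :+ (x :+ (y :+ z))) refl (s 0F) (s 1F) (s 2F) (s 3F)
    where open +-*-Solver

-- A projective point has three coordinate vectors; the zero vector accounts for `f nothing`.
sumᵛ-norm : ∀ n f → sumᵛ (suc n) (f ∘ norm) ≡ f nothing + 3 * total (f ∘ just)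
sumᵛ-norm zero    f = solve 2 (λ o p → o :+ (p :+ (p :+ (p :+ con 0))) := o :+ con 3 :* (p :+ con 0)) refl (f nothing) (f (just (fin [])))
  where open +-*-Solver
sumᵛ-norm (suc n) f = begin
  sumᵛ (suc (suc n)) (f ∘ norm)
    ≡⟨ sumᵛ-suc (suc n) (f ∘ norm) ⟩
  sumᵛ (suc n) (f ∘ Maybe.map far ∘ norm) + (slice 1F + (slice 2F + slice 3F))
    ≡⟨ cong₂ _+_ (sumᵛ-norm n (f ∘ Maybe.map far)) (cong₂ _+_ (scale 1F λ ()) (cong₂ _+_ (scale 2F λ ()) (scale 3F λ ()))) ⟩
  f nothing + 3 * B + (A + (A + A))
    ≡⟨ solve 3 (λ o a b → (o :+ con 3 :* b) :+ (a :+ (a :+ a)) := o :+ con 3 :* (a :+ b)) refl (f nothing) A B ⟩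
  f nothing + 3 * (A + B)
    ≡⟨ cong (λ s → f nothing + 3 * s) (total-suc (f ∘ just)) ⟨
  f nothing + 3 * total (f ∘ just) ∎
  where
  open ≡-Reasoning
  open +-*-Solver
  A = sumᵛ (suc n) (f ∘ just ∘ fin)
  B = total (f ∘ just ∘ far)
  slice : F → ℕ
  slice c = sumᵛ (suc n) (λ x → f (just (fin (inv c · x))))
  scale : ∀ c → c ≢ 0F → slice c ≡ A
  scale c c≢0 = sumᵛ-scale (suc n) (f ∘ just ∘ fin) (inv-nonzero c c≢0)

-- Selects the first m points of a list. A fixed order makes the selected sets nested, as the cone
-- construction requires.
mark : ∀ {n} → ℕ → List (Point n) → Point n → Bool
mark zero    _        _ = false
mark (suc m) []       _ = false
mark (suc m) (q ∷ qs) p = does (p ≟ᴾ q) ∨ mark m qs p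

mark-mono : ∀ {n k m} (qs : List (Point n)) p → k ≤ m → T (mark k qs p) → T (mark m qs p)
mark-mono (q ∷ qs) p (s≤s k≤m) t with does (p ≟ᴾ q)
... | true  = tt
... | false = mark-mono qs p k≤m t

mark⇒∈take : ∀ {n} m (qs : List (Point n)) p → T (mark m qs p) → p ∈ take m qs
mark⇒∈take (suc m) (q ∷ qs) p t with p ≟ᴾ q
... | yes p≡q = here p≡q
... | no  _   = there (mark⇒∈take m qs p t)

-- There are m values `f true` and `length qs` minus m values `f false`; the term `m * f false` on
-- the left avoids the subtraction.
sum-mark : ∀ {n} m (qs : List (Point n)) → Unique qs → m ≤ length qs → ∀ f →
           sum (map (f ∘ mark m qs) qs) + m * f false ≡ length qs * f false + m * f true
sum-mark zero    qs       _          _         f = cong (_+ 0) (sum-map-const (f false) qs)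
sum-mark (suc m) (q ∷ qs) (q∉ ∷ qs!) (s≤s m≤) f = begin
  (f (does (q ≟ᴾ q) ∨ mark m qs q) + sum (map (f ∘ mark (suc m) (q ∷ qs)) qs)) + (f false + m * f false)
    ≡⟨ cong₂ (λ b s → (f (b ∨ mark m qs q) + s) + (f false + m * f false)) (dec-true (q ≟ᴾ q) refl)
         (cong sum (Listₚ.map-cong-local (All.map (λ {p} q≢p → cong (λ b → f (b ∨ mark m qs p)) (dec-false (p ≟ᴾ q) (q≢p ∘ sym))) q∉))) ⟩
  (f true + S) + (f false + m * f false)
    ≡⟨ solve 4 (λ t s o r → (t :+ s) :+ (o :+ r) := (o :+ t) :+ (s :+ r)) refl (f true) S (f false) (m * f false) ⟩
  (f false + f true) + (S + m * f false)
    ≡⟨ cong ((f false + f true) +_) (sum-mark m qs qs! m≤ f) ⟩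
  (f false + f true) + (length qs * f false + m * f true)
    ≡⟨ solve 4 (λ o t l r → (o :+ t) :+ (l :+ r) := (o :+ l) :+ (t :+ r)) refl (f false) (f true) (length qs * f false) (m * f true) ⟩
  (f false + length qs * f false) + (f true + m * f true) ∎
  where
  open ≡-Reasoning
  open +-*-Solver
  S = sum (map (f ∘ mark m qs) qs)

total-mark : ∀ n {m} → m ≤ [ n ]₄ → ∀ f → total (f ∘ mark m (points n)) + m * f false ≡ [ n ]₄ * f false + m * f true
total-mark n {m} m≤ f = trans (sum-mark m (points n) (points-! n) (subst (m ≤_) (sym (length-points n)) m≤) f)
  (cong (λ l → l * f false + m * f true) (length-points n))

-- Admissible weightings with weights 0, 1 and 3

word : ∀ {n} → (Point n → Weight) → Line n → Vec Weight 5
word ω ℓ = Vec.tabulate (λ i → ω (ℓ at i))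

AdmissibleWeights : ∀ {n} → (Point n → Weight) → Set
AdmissibleWeights ω = ∀ ℓ → Admissible (word ω ℓ)

realise : ∀ {n} (ω : Point n → Weight) → AdmissibleWeights ω → PBDBound (total (val ∘ ω)) 63
realise {n} ω admissible = weighted-PBD 3 [] λ p k k< → inj₁ (ℕₚ.≤-trans k< (val≤3 (ω p)))
  where
  fill : ∀ a → 2 ≤ val a → InK (val a)
  fill 1F (s≤s ())
  fill 2F _ = inj₁ refl
  val≤3 : ∀ a → val a ≤ 3
  val≤3 0F = z≤n
  val≤3 1F = s≤s z≤n
  val≤3 2F = ℕₚ.≤-refl
  open Weighted (val ∘ ω) (fill ∘ ω) (λ ℓ → GDD-cong (λ i → cong val (Vecₚ.lookup∘tabulate (λ j → ω (ℓ at j)) i)) (gdd₁₃ (word ω ℓ) (admissible ℓ)))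

Realisable : ℕ → ℕ → Set
Realisable n v = ∃ λ (ω : Point n → Weight) → AdmissibleWeights ω × total (val ∘ ω) ≡ v

realisable-PBD : ∀ {n v} → Realisable n v → PBDBound v 63
realisable-PBD (ω , admissible , refl) = realise ω admissible

admissible? : ∀ ω → Dec (Admissible ω)
admissible? ω = Boolₚ.T? (Maybe.is-just (ingredient ω))

-- All six types with five nonempty groups have a template.
nonzero-admissible : ∀ a b c d e → a ≢ 0F → b ≢ 0F → c ≢ 0F → d ≢ 0F → e ≢ 0F → Admissible (a ∷ b ∷ c ∷ d ∷ e ∷ [])
nonzero-admissible = toWitness {a? = Finₚ.all? λ a → Finₚ.all? λ b → Finₚ.all? λ c → Finₚ.all? λ d → Finₚ.all? λ e →
  nz a →-dec nz b →-dec nz c →-dec nz d →-dec nz e →-dec admissible? (a ∷ b ∷ c ∷ d ∷ e ∷ [])} tt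
  where
  nz : ∀ a → Dec (a ≢ 0F)
  nz a = ¬? (a Finₚ.≟ 0F)

weight : Bool → Weight
weight b = if b then 2F else 1F

weight-nonzero : ∀ b → weight b ≢ 0F
weight-nonzero false ()
weight-nonzero true  ()

total-weight-mark : ∀ n {m} → m ≤ [ n ]₄ → total (val ∘ weight ∘ mark m (points n)) ≡ [ n ]₄ + 2 * m
total-weight-mark n {m} m≤ = ℕₚ.+-cancelʳ-≡ (m * 1) _ _ (trans (total-mark n m≤ (val ∘ weight))
  (solve 2 (λ l m → l :* con 1 :+ m :* con 3 := (l :+ con 2 :* m) :+ m :* con 1) refl [ n ]₄ m))
  where open +-*-Solver

odd-realisable : ∀ n {m} → m ≤ [ n ]₄ → Realisable n ([ n ]₄ + 2 * m)
odd-realisable n {m} m≤ = ω , (λ ℓ → nonzero-admissible _ _ _ _ _ (nz (ℓ at 0F)) (nz (ℓ at 1F)) (nz (ℓ at 2F)) (nz (ℓ at 3F)) (nz (ℓ at 4F))) , total-weight-mark n m≤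
  where
  ω = weight ∘ mark m (points n)
  nz : ∀ p → ω p ≢ 0F
  nz p = weight-nonzero (mark m (points n) p)

0⃗ : ∀ {n} → Vec F n
0⃗ {n} = Vec.replicate n 0F

place-0 : ∀ {n} (d : Point n) t → place d t 0⃗ ≡ t · vec d
place-0 (fin δ) t = cong₂ _∷_ (sym (⊗-identityʳ t)) (pointwise δ)
  where
  pointwise : ∀ {n} (δ : Vec F n) → Vec.zipWith (λ x y → y ⊕ t ⊗ x) δ 0⃗ ≡ t · δ
  pointwise []      = refl
  pointwise (x ∷ δ) = cong (t ⊗ x ∷_) (pointwise δ)
place-0 (far d) t = cong₂ _∷_ (sym (⊗-zeroʳ t)) (place-0 d t)

0·x≡0⃗ : ∀ {n} (x : Vec F n) → 0F · x ≡ 0⃗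
0·x≡0⃗ []      = refl
0·x≡0⃗ (a ∷ x) = cong (0F ∷_) (0·x≡0⃗ x)

-- The cone over a weighting of the hyperplane at infinity, from the vertex fin 0⃗ of weight 0: the affine part and the hyperplane itself may be weighted differently.
module Cone {n} (f g : Point n → Weight) where
  affine : Maybe (Point n) → Weight
  affine nothing  = 0F
  affine (just p) = f p

  cone : Point (suc n) → Weight
  cone (fin x) = affine (norm x)
  cone (far p) = g p

  -- Each line through the vertex carries three further affine points, weighted by `f`, and one
  -- point at infinity, weighted by `g`.
  total-cone : total (val ∘ cone) ≡ 3 * total (val ∘ f) + total (val ∘ g)
  total-cone = trans (total-suc (val ∘ cone)) (cong (_+ total (val ∘ g)) (sumᵛ-norm n (val ∘ affine)))

  module _ (f≢0 : ∀ p → f p ≢ 0F) (g≢0 : ∀ p → g p ≢ 0F) (vertex : ∀ p → Admissible (g p ∷ 0F ∷ f p ∷ f p ∷ f p ∷ [])) where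
    -- Only lines through the vertex contain a point of weight 0. They are the affine lines with
    -- base vector zero, whose affine points are the multiples of the direction.
    cone-admissible : AdmissibleWeights cone
    cone-admissible (inf ℓ) = nonzero-admissible _ _ _ _ _ (g≢0 (ℓ at 0F)) (g≢0 (ℓ at 1F)) (g≢0 (ℓ at 2F)) (g≢0 (ℓ at 3F)) (g≢0 (ℓ at 4F))
    cone-admissible (aff d a) with Vecₚ.≡-dec _≟_ a 0⃗
    ... | yes refl = subst₂ (λ o ws → Admissible (g d ∷ o ∷ ws))
      (cong affine (sym (trans (cong norm (trans (place-0 d 0F) (0·x≡0⃗ (vec d)))) (norm-0 n))))
      (cong₂ _∷_ (ray 1F λ ()) (cong₂ _∷_ (ray 2F λ ()) (cong₂ _∷_ (ray 3F λ ()) refl))) (vertex d)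
      where
      ray : ∀ t → t ≢ 0F → f d ≡ affine (norm (place d t 0⃗))
      ray t t≢0 = cong affine (sym (trans (cong norm (place-0 d t)) (norm-· t d t≢0)))
    ... | no a≢0 = nonzero-admissible _ _ _ _ _ (g≢0 d) (nz 0F) (nz 1F) (nz 2F) (nz 3F)
      where
      nz : ∀ t → affine (norm (place d t a)) ≢ 0F
      nz t eq with norm (place d t a) in eqⁿ
      ... | nothing = a≢0 (proj₂ (place-injective d (trans (norm-nothing (place d t a) eqⁿ) (sym (trans (place-0 d 0F) (0·x≡0⃗ (vec d)))))))
      ... | just p = f≢0 p eq

even-realisable : ∀ n {k m} → k ≤ m → m ≤ [ n ]₄ → Realisable (suc n) (4 * [ n ]₄ + 2 * (3 * m + k))
even-realisable n {k} {m} k≤m m≤ = cone , cone-admissible (weight-nonzero ∘ μ m) (weight-nonzero ∘ μ k) (λ p → vertex (μ k p) (μ m p) (mark-mono (points n) p k≤m)) ,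
  trans total-cone (trans (cong₂ (λ s t → 3 * s + t) (total-weight-mark n m≤) (total-weight-mark n (ℕₚ.≤-trans k≤m m≤)))
    (solve 3 (λ l m k → con 3 :* (l :+ con 2 :* m) :+ (l :+ con 2 :* k) := con 4 :* l :+ con 2 :* (con 3 :* m :+ k)) refl [ n ]₄ m k))
  where
  open +-*-Solver
  μ : ℕ → Point n → Bool
  μ m = mark m (points n)
  open Cone (weight ∘ μ m) (weight ∘ μ k)
  vertex : ∀ a b → (T a → T b) → Admissible (weight a ∷ 0F ∷ weight b ∷ weight b ∷ weight b ∷ [])
  vertex false false _ = tt
  vertex false true  _ = tt
  -- The word 3, 0, 1, 1, 1 has no template; `k ≤ m` excludes it.
  vertex true  false p = ⊥-elim (p tt)
  vertex true  true  _ = tt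

-- A line outside the hyperplane has four points of weight 1 and meets the hyperplane in a single
-- point, which may have any weight.
affine-extension : ∀ {n v} → Realisable n v → Realisable (suc n) (4 ^ suc n + v)
affine-extension {n} (ω , admissible , eq) = ω′ , (λ where
    (aff d a) → any-1111 (ω d)
    (inf ℓ)   → admissible ℓ) ,
  trans (total-suc (val ∘ ω′)) (cong₂ _+_ (sumᵛ-1 (suc n)) eq)
  where
  ω′ : Point (suc n) → Weight
  ω′ (fin _) = 1F
  ω′ (far p) = ω p
  any-1111 : ∀ a → Admissible (a ∷ 1F ∷ 1F ∷ 1F ∷ 1F ∷ [])
  any-1111 0F = tt
  any-1111 1F = tt
  any-1111 2F = tt

-- The class of the point of PG(2,4) with the given coordinates: 0F to 5F for the points of the hyperoval formed by the conic y z = x² and its nucleus, 6F for the other points, 7F for the zero vector.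
class : Vec F 3 → Fin 8
class (0F ∷ 0F ∷ 0F ∷ []) = 7F
class (0F ∷ 0F ∷ _  ∷ []) = 2F
class (0F ∷ _  ∷ 0F ∷ []) = 1F
class (_  ∷ 0F ∷ 0F ∷ []) = 0F
class (0F ∷ _  ∷ _  ∷ []) = 6F
class (_  ∷ 0F ∷ _  ∷ []) = 6F
class (_  ∷ _  ∷ 0F ∷ []) = 6F
class (x  ∷ y  ∷ z  ∷ []) = if does (y ⊗ z ≟ x ⊗ x) then conic (inv x ⊗ y) else 6F
  where
  conic : F → Fin 8
  conic 2F = 4F
  conic 3F = 5F
  conic _  = 3F

plain : Fin 8 → Bool
plain 6F = true
plain _  = false

bit : Bool → ℕ
bit b = if b then 1 else 0

-- The classes of f and of e + t f for the four t. Independent e and f give a line, with at most two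
-- points on the hyperoval; otherwise the nonzero ones among these vectors are proportional.
LineShape : (k l₀ l₁ l₂ l₃ : Fin 8) → Set
LineShape k l₀ l₁ l₂ l₃ =
    3 ≤ bit (plain k) + (bit (plain l₀) + (bit (plain l₁) + (bit (plain l₂) + bit (plain l₃))))
  ⊎ (k ≡ 7F × l₁ ≡ l₀ × l₂ ≡ l₀ × l₃ ≡ l₀)
  ⊎ (l₀ ≡ 7F × l₁ ≡ k × l₂ ≡ k × l₃ ≡ k)
  ⊎ (l₁ ≡ 7F × l₀ ≡ k × l₂ ≡ k × l₃ ≡ k)
  ⊎ (l₂ ≡ 7F × l₀ ≡ k × l₁ ≡ k × l₃ ≡ k)
  ⊎ (l₃ ≡ 7F × l₀ ≡ k × l₁ ≡ k × l₂ ≡ k)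

lineShape? : ∀ k l₀ l₁ l₂ l₃ → Dec (LineShape k l₀ l₁ l₂ l₃)
lineShape? k l₀ l₁ l₂ l₃ =
    (3 ≤? bit (plain k) + (bit (plain l₀) + (bit (plain l₁) + (bit (plain l₂) + bit (plain l₃)))))
  ⊎-dec ((k ≟⁸ 7F ×-dec l₁ ≟⁸ l₀ ×-dec l₂ ≟⁸ l₀ ×-dec l₃ ≟⁸ l₀)
  ⊎-dec ((l₀ ≟⁸ 7F ×-dec l₁ ≟⁸ k ×-dec l₂ ≟⁸ k ×-dec l₃ ≟⁸ k)
  ⊎-dec ((l₁ ≟⁸ 7F ×-dec l₀ ≟⁸ k ×-dec l₂ ≟⁸ k ×-dec l₃ ≟⁸ k)
  ⊎-dec ((l₂ ≟⁸ 7F ×-dec l₀ ≟⁸ k ×-dec l₁ ≟⁸ k ×-dec l₃ ≟⁸ k)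
  ⊎-dec (l₃ ≟⁸ 7F ×-dec l₀ ≟⁸ k ×-dec l₁ ≟⁸ k ×-dec l₂ ≟⁸ k)))))
  where
  infix 7 _≟⁸_
  _≟⁸_ : DecidableEquality (Fin 8)
  _≟⁸_ = Finₚ._≟_

class-line : ∀ x y z u v w → let l = λ t → class (x ⊕ t ⊗ u ∷ y ⊕ t ⊗ v ∷ z ⊕ t ⊗ w ∷ []) in
             LineShape (class (u ∷ v ∷ w ∷ [])) (l 0F) (l 1F) (l 2F) (l 3F)
class-line = toWitness {a? = ∀F? λ x → ∀F? λ y → ∀F? λ z → ∀F? λ u → ∀F? λ v → ∀F? λ w →
  let l = λ t → class (x ⊕ t ⊗ u ∷ y ⊕ t ⊗ v ∷ z ⊕ t ⊗ w ∷ []) in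
  lineShape? (class (u ∷ v ∷ w ∷ [])) (l 0F) (l 1F) (l 2F) (l 3F)} tt

-- For c at most 6 this keeps the first c points of the hyperoval. Plain points always stay; the
-- centre of projection, of class `7F`, never does.
present : ℕ → Fin 8 → Bool
present c 7F = false
present c 6F = true
present c i  = toℕ i <ᵇ c

zeroOne : Bool → Weight
zeroOne b = if b then 1F else 0F

three-ones : ∀ a b c d e p q r s t → 3 ≤ bit p + (bit q + (bit r + (bit s + bit t))) →
  (T p → T a) → (T q → T b) → (T r → T c) → (T s → T d) → (T t → T e) →
  Admissible (zeroOne a ∷ zeroOne b ∷ zeroOne c ∷ zeroOne d ∷ zeroOne e ∷ [])
three-ones = toWitness {a? = ∀Bool? λ a → ∀Bool? λ b → ∀Bool? λ c → ∀Bool? λ d → ∀Bool? λ e →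
  ∀Bool? λ p → ∀Bool? λ q → ∀Bool? λ r → ∀Bool? λ s → ∀Bool? λ t →
  (3 ≤? bit p + (bit q + (bit r + (bit s + bit t)))) →-dec (p ⇒ a) →-dec (q ⇒ b) →-dec (r ⇒ c) →-dec (s ⇒ d) →-dec (t ⇒ e) →-dec
  admissible? (zeroOne a ∷ zeroOne b ∷ zeroOne c ∷ zeroOne d ∷ zeroOne e ∷ [])} tt
  where
  _⇒_ : ∀ p a → Dec (T p → T a)
  p ⇒ a = Boolₚ.T? p →-dec Boolₚ.T? a

plain⇒present : ∀ c i → T (plain i) → T (present c i)
plain⇒present c 6F _ = tt

-- If the line projects onto a line, its plain points give three ones. Otherwise its points outside
-- the centre lie over one point: either four affine ones, or three affine ones and the one at
-- infinity, whose threshold `c′` may differ. The number of ones is then 0, 1, 3 or 4.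
lineShape-admissible : ∀ c c′ {k l₀ l₁ l₂ l₃} → LineShape k l₀ l₁ l₂ l₃ →
  Admissible (zeroOne (present c′ k) ∷ zeroOne (present c l₀) ∷ zeroOne (present c l₁) ∷ zeroOne (present c l₂) ∷ zeroOne (present c l₃) ∷ [])
lineShape-admissible c c′ {k} {l₀} {l₁} {l₂} {l₃} = λ where
    (inj₁ 3≤) → three-ones (present c′ k) (present c l₀) (present c l₁) (present c l₂) (present c l₃) (plain k) (plain l₀) (plain l₁) (plain l₂) (plain l₃) 3≤
      (plain⇒present c′ k) (plain⇒present c l₀) (plain⇒present c l₁) (plain⇒present c l₂) (plain⇒present c l₃)
    (inj₂ (inj₁ (refl , refl , refl , refl)))                      → all-but-first (present c l₀)
    (inj₂ (inj₂ (inj₁ (refl , refl , refl , refl))))               → ray₀ (present c′ k) (present c k)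
    (inj₂ (inj₂ (inj₂ (inj₁ (refl , refl , refl , refl)))))        → ray₁ (present c′ k) (present c k)
    (inj₂ (inj₂ (inj₂ (inj₂ (inj₁ (refl , refl , refl , refl)))))) → ray₂ (present c′ k) (present c k)
    (inj₂ (inj₂ (inj₂ (inj₂ (inj₂ (refl , refl , refl , refl)))))) → ray₃ (present c′ k) (present c k)
  where
  all-but-first : ∀ b → Admissible (0F ∷ zeroOne b ∷ zeroOne b ∷ zeroOne b ∷ zeroOne b ∷ [])
  all-but-first false = tt
  all-but-first true  = tt
  ray₀ : ∀ a b → Admissible (zeroOne a ∷ 0F ∷ zeroOne b ∷ zeroOne b ∷ zeroOne b ∷ [])
  ray₀ = toWitness {a? = ∀Bool? λ a → ∀Bool? λ b → admissible? (zeroOne a ∷ 0F ∷ zeroOne b ∷ zeroOne b ∷ zeroOne b ∷ [])} tt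
  ray₁ : ∀ a b → Admissible (zeroOne a ∷ zeroOne b ∷ 0F ∷ zeroOne b ∷ zeroOne b ∷ [])
  ray₁ = toWitness {a? = ∀Bool? λ a → ∀Bool? λ b → admissible? (zeroOne a ∷ zeroOne b ∷ 0F ∷ zeroOne b ∷ zeroOne b ∷ [])} tt
  ray₂ : ∀ a b → Admissible (zeroOne a ∷ zeroOne b ∷ zeroOne b ∷ 0F ∷ zeroOne b ∷ [])
  ray₂ = toWitness {a? = ∀Bool? λ a → ∀Bool? λ b → admissible? (zeroOne a ∷ zeroOne b ∷ zeroOne b ∷ 0F ∷ zeroOne b ∷ [])} tt
  ray₃ : ∀ a b → Admissible (zeroOne a ∷ zeroOne b ∷ zeroOne b ∷ zeroOne b ∷ 0F ∷ [])
  ray₃ = toWitness {a? = ∀Bool? λ a → ∀Bool? λ b → admissible? (zeroOne a ∷ zeroOne b ∷ zeroOne b ∷ zeroOne b ∷ 0F ∷ [])} tt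

layerWeight : ℕ → Vec F 3 → Weight
layerWeight c q = zeroOne (present c (class q))

layer-line : ∀ c c′ (e f : Vec F 3) → Admissible
  (layerWeight c′ f ∷ layerWeight c (lin 1F 0F e f) ∷ layerWeight c (lin 1F 1F e f) ∷ layerWeight c (lin 1F 2F e f) ∷ layerWeight c (lin 1F 3F e f) ∷ [])
layer-line c c′ (x ∷ y ∷ z ∷ []) (u ∷ v ∷ w ∷ []) = lineShape-admissible c c′ (class-line x y z u v w)

last₃ : ∀ k → Vec F (suc (k + 2)) → Vec F 3
last₃ zero    x       = x
last₃ (suc k) (_ ∷ x) = last₃ k x

last₃-lin : ∀ k α β x y → last₃ k (lin α β x y) ≡ lin α β (last₃ k x) (last₃ k y)
last₃-lin zero    α β x       y       = refl
last₃-lin (suc k) α β (_ ∷ x) (_ ∷ y) = last₃-lin k α β x y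

-- PG(k+2,4) projected onto PG(2,4) from a subspace PG(k-1,4) of weight 0; the fibres over the first cs(j) points of the hyperoval are kept in the layer where the leading coordinate has index j.
layered : ∀ k → Vec ℕ (suc k) → Point (k + 2) → Weight
layered zero    (c ∷ _)  p       = layerWeight c (vec p)
layered (suc k) (c ∷ _)  (fin x) = layerWeight c (last₃ k x)
layered (suc k) (_ ∷ cs) (far p) = layered k cs p

-- The direction of an affine line may lie in any later layer; only the threshold of that layer
-- matters.
layered-layer : ∀ k cs p → ∃ λ c → layered k cs p ≡ layerWeight c (last₃ k (vec p))
layered-layer zero    (c ∷ _)  p       = c , refl
layered-layer (suc k) (c ∷ _)  (fin x) = c , refl
layered-layer (suc k) (_ ∷ cs) (far p) = layered-layer k cs p

layered-admissible : ∀ k cs → AdmissibleWeights (layered k cs)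
layered-admissible zero (c ∷ _) ℓ = let (e , f , eq) = parametrise ℓ in
  subst Admissible (Vecₚ.tabulate-cong (λ i → cong (layerWeight c) (sym (eq i))))
    (subst (λ x → Admissible (layerWeight c x ∷ layerWeight c (lin 1F 0F e f) ∷ layerWeight c (lin 1F 1F e f) ∷ layerWeight c (lin 1F 2F e f) ∷ layerWeight c (lin 1F 3F e f) ∷ []))
      (sym (lin-01 e f)) (layer-line c c e f))
layered-admissible (suc k) (c ∷ cs) (inf ℓ) = layered-admissible k cs ℓ
layered-admissible (suc k) (c ∷ cs) (aff d a) = let (c′ , eq) = layered-layer k cs d in
  subst Admissible (cong₂ _∷_ (sym eq) (Vecₚ.tabulate-cong λ t → cong (layerWeight c)
      (sym (trans (cong (last₃ k) (place-affine d t a)) (last₃-lin k 1F t (place d 0F a) (vec d))))))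
    (layer-line c c′ (last₃ k (place d 0F a)) (last₃ k (vec d)))

sumᵛ-last₃ : ∀ k h → sumᵛ (suc (k + 2)) (h ∘ last₃ k) ≡ 4 ^ k * sumᵛ 3 h
sumᵛ-last₃ zero    h = sym (ℕₚ.+-identityʳ (sumᵛ 3 h))
sumᵛ-last₃ (suc k) h = trans (sumᵛ-suc (suc (k + 2)) (h ∘ last₃ (suc k))) (trans (cong (λ s → s + (s + (s + s))) (sumᵛ-last₃ k h))
  (solve 2 (λ p s → let ps = p :* s in ps :+ (ps :+ (ps :+ ps)) := (con 4 :* p) :* s) refl (4 ^ k) (sumᵛ 3 h)))
  where open +-*-Solver

check≤6 : ∀ {P : ℕ → Set} (P? : ∀ c → Dec (P c)) → True (Finₚ.all? {n = 7} (P? ∘ toℕ)) → ∀ {c} → c ≤ 6 → P c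
check≤6 {P} P? ok c≤6 = subst P (Finₚ.toℕ-fromℕ< (s≤s c≤6)) (toWitness {a? = Finₚ.all? {n = 7} (P? ∘ toℕ)} ok (fromℕ< (s≤s c≤6)))

total-layer₀ : ∀ {c} → c ≤ 6 → total {2} (λ p → val (layerWeight c (vec p))) ≡ 15 + c
total-layer₀ = check≤6 (λ c → total {2} (λ p → val (layerWeight c (vec p))) ℕₚ.≟ 15 + c) tt

-- Three vectors for each of the `15 + c` points kept; the zero vector has weight 0.
sumᵛ-layer : ∀ {c} → c ≤ 6 → sumᵛ 3 (val ∘ layerWeight c) ≡ 3 * (15 + c)
sumᵛ-layer = check≤6 (λ c → sumᵛ 3 (val ∘ layerWeight c) ℕₚ.≟ 3 * (15 + c)) tt

-- The least digit leaving at most `2 * u` is chosen. In the use below u is `3 * 4 ^ k`, the gain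
-- from one more fibre in the leading layer, and `2 * u` is what the later layers can absorb.
greedy : ∀ u c {s} → s ≤ c * u + 2 * u → ∃₂ λ d r → d ≤ c × r ≤ 2 * u × s ≡ d * u + r
greedy u zero    {s} s≤ = 0 , s , z≤n , s≤ , refl
greedy u (suc c) {s} s≤ with s ≤? c * u + 2 * u
... | yes s≤′ = let (d , r , d≤c , r≤ , eq) = greedy u c s≤′ in d , r , ℕₚ.m≤n⇒m≤1+n d≤c , r≤ , eq
... | no  s≰ = suc c , s ∸ suc c * u , ℕₚ.≤-refl , ℕₚ.m≤n+o⇒m∸n≤o s (suc c * u) s≤ , sym (ℕₚ.m+[n∸m]≡n (begin
    u + c * u        ≡⟨ ℕₚ.+-comm u (c * u) ⟩
    c * u + u        ≤⟨ ℕₚ.+-monoʳ-≤ (c * u) (ℕₚ.m≤m+n u (u + 0)) ⟩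
    c * u + 2 * u    <⟨ ℕₚ.≰⇒> s≰ ⟩
    s                ∎))
  where open ℕₚ.≤-Reasoning

layered-suc : ∀ k {c r s} cs → c ≤ 6 → total (val ∘ layered k cs) ≡ 15 * 4 ^ k + r → s ≡ c * (3 * 4 ^ k) + r →
              total (val ∘ layered (suc k) (c ∷ cs)) ≡ 15 * 4 ^ suc k + s
layered-suc k {c} {r} cs c≤6 eq refl = begin
  total (val ∘ layered (suc k) (c ∷ cs))
    ≡⟨ total-suc (val ∘ layered (suc k) (c ∷ cs)) ⟩
  sumᵛ (suc (k + 2)) (val ∘ layerWeight c ∘ last₃ k) + total (val ∘ layered k cs)
    ≡⟨ cong₂ _+_ (trans (sumᵛ-last₃ k (val ∘ layerWeight c)) (cong (4 ^ k *_) (sumᵛ-layer c≤6))) eq ⟩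
  4 ^ k * (3 * (15 + c)) + (15 * 4 ^ k + r)
    ≡⟨ solve 3 (λ p c r → p :* (con 3 :* (con 15 :+ c)) :+ (con 15 :* p :+ r) := con 15 :* (con 4 :* p) :+ (c :* (con 3 :* p) :+ r)) refl (4 ^ k) c r ⟩
  15 * 4 ^ suc k + (c * (3 * 4 ^ k) + r) ∎
  where
  open ≡-Reasoning
  open +-*-Solver

layered-total : ∀ k {s} → s ≤ 6 * 4 ^ k → ∃ λ cs → total (val ∘ layered k cs) ≡ 15 * 4 ^ k + s
layered-total zero    {s} s≤ = (s ∷ []) , total-layer₀ s≤
layered-total (suc k) {s} s≤ = extend (greedy (3 * 4 ^ k) 6 (subst (s ≤_) regroup s≤))
  where
  regroup : 6 * 4 ^ suc k ≡ 6 * (3 * 4 ^ k) + 2 * (3 * 4 ^ k)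
  regroup = trans (sym (ℕₚ.*-assoc 6 4 (4 ^ k))) (trans (ℕₚ.*-assoc 8 3 (4 ^ k)) (ℕₚ.*-distribʳ-+ (3 * 4 ^ k) 6 2))
  extend : (∃₂ λ c r → c ≤ 6 × r ≤ 2 * (3 * 4 ^ k) × s ≡ c * (3 * 4 ^ k) + r) →
           ∃ λ cs → total (val ∘ layered (suc k) cs) ≡ 15 * 4 ^ suc k + s
  extend (c , r , c≤6 , r≤ , s≡) =
    let (cs , eq) = layered-total k (subst (r ≤_) (sym (ℕₚ.*-assoc 2 3 (4 ^ k))) r≤) in (c ∷ cs) , layered-suc k cs c≤6 eq s≡

layered-realisable : ∀ k {s} → s ≤ 6 * 4 ^ k → Realisable (k + 2) (15 * 4 ^ k + s)
layered-realisable k s≤ = let (cs , eq) = layered-total k s≤ in layered k cs , layered-admissible k cs , eq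

-- Up to `21 * 4 ^ k` the layered weights suffice. Beyond, the whole affine part gets weight 1, and
-- the rest of v lies in the same range one dimension lower, because 84 is at least 64 + 15.
wide-realisable : ∀ k {v} → 15 * 4 ^ k ≤ v → v ≤ [ k + 2 ]₄ → Realisable (k + 2) v
wide-realisable k {v} lo hi with v ≤? 15 * 4 ^ k + 6 * 4 ^ k
... | yes v≤ = subst (Realisable (k + 2)) (ℕₚ.m+[n∸m]≡n lo) (layered-realisable k (ℕₚ.m≤n+o⇒m∸n≤o v (15 * 4 ^ k) v≤))
-- For PG(2,4) the layered weights already reach all 15 + 6 = 21 points.
wide-realisable zero    {v} lo hi | no v≰ = contradiction hi v≰
wide-realisable (suc k) {v} lo hi | no v≰ = subst (Realisable (suc (k + 2))) (ℕₚ.m+[n∸m]≡n affine≤v) (affine-extension (wide-realisable k lo′ hi′))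
  where
  open ℕₚ.≤-Reasoning
  A = 4 ^ suc (k + 2)
  A≡ : A ≡ 64 * 4 ^ k
  A≡ = trans (cong (4 *_) (ℕₚ.^-distribˡ-+-* 4 k 2)) (+-*-Solver.solve 1 (λ p → +-*-Solver.con 4 +-*-Solver.:* (p +-*-Solver.:* +-*-Solver.con 16) +-*-Solver.:= +-*-Solver.con 64 +-*-Solver.:* p) refl (4 ^ k))
  lower : A + 15 * 4 ^ k ≤ v
  lower = begin
    A + 15 * 4 ^ k                    ≡⟨ cong (_+ 15 * 4 ^ k) A≡ ⟩
    64 * 4 ^ k + 15 * 4 ^ k           ≡⟨ ℕₚ.*-distribʳ-+ (4 ^ k) 64 15 ⟨
    79 * 4 ^ k                        ≤⟨ ℕₚ.*-monoˡ-≤ (4 ^ k) (ℕₚ.m≤m+n 79 5) ⟩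
    84 * 4 ^ k                        ≡⟨ ℕₚ.*-assoc 21 4 (4 ^ k) ⟩
    21 * 4 ^ suc k                    ≡⟨ ℕₚ.*-distribʳ-+ (4 ^ suc k) 15 6 ⟩
    15 * 4 ^ suc k + 6 * 4 ^ suc k    <⟨ ℕₚ.≰⇒> v≰ ⟩
    v                                 ∎
  affine≤v : A ≤ v
  affine≤v = ℕₚ.m+n≤o⇒m≤o A lower
  lo′ : 15 * 4 ^ k ≤ v ∸ A
  lo′ = ℕₚ.m+n≤o⇒m≤o∸n (15 * 4 ^ k) (subst (_≤ v) (ℕₚ.+-comm A (15 * 4 ^ k)) lower)
  hi′ : v ∸ A ≤ [ k + 2 ]₄
  hi′ = ℕₚ.m≤n+o⇒m∸n≤o v A (subst (v ≤_) (repunit-suc (k + 2)) hi)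

-- Arithmetic of the orders

-- Only the m marked points have a fifth copy, so wherever they lie, at most 21 * 4 + m elements lie
-- over a plane.
four-five-PBD : ∀ n {m} → m ≤ [ n ]₄ → PBDBound (4 * [ n ]₄ + m) (84 + m)
four-five-PBD n {m} m≤ = subst₂ PBDBound total≡ (cong (84 +_) length-extra) (weighted-PBD 4 extra (λ p k → bounded p k (five p) refl))
  where
  open +-*-Solver
  five : Point n → Bool
  five = mark m (points n)
  fill : ∀ b → 2 ≤ val₄₅ b → InK (val₄₅ b)
  fill false _ = inj₂ (inj₁ refl)
  fill true  _ = inj₂ (inj₂ refl)
  open Weighted (val₄₅ ∘ five) (fill ∘ five)
    (λ ℓ → GDD-cong (λ i → cong val₄₅ (Vecₚ.lookup∘tabulate (λ j → five (ℓ at j)) i)) (gdd₄₅ (Vec.tabulate (λ i → five (ℓ at i)))))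
  extra : List (Point n × ℕ)
  extra = map (_, 4) (take m (points n))
  length-extra : length extra ≡ m
  length-extra = trans (Listₚ.length-map (_, 4) (take m (points n))) (trans (Listₚ.length-take m (points n))
    (trans (cong (m ⊓_) (length-points n)) (ℕₚ.m≤n⇒m⊓n≡m m≤)))
  bounded : ∀ p k b → five p ≡ b → k < val₄₅ (five p) → k < 4 ⊎ (p , k) ∈ extra
  bounded p k false eq k< = inj₁ (subst (λ c → k < val₄₅ c) eq k<)
  bounded p k true  eq k< with ℕₚ.m≤n⇒m<n∨m≡n (ℕₚ.≤-pred (subst (λ c → k < val₄₅ c) eq k<))
  ... | inj₁ k<4  = inj₁ k<4
  ... | inj₂ refl = inj₂ (Memₚ.∈-map⁺ (_, 4) (mark⇒∈take m (points n) p (subst T (sym eq) tt)))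
  total≡ : total (val₄₅ ∘ five) ≡ 4 * [ n ]₄ + m
  total≡ = ℕₚ.+-cancelʳ-≡ (m * 4) _ _ (trans (total-mark n m≤ val₄₅)
    (solve 2 (λ l m → l :* con 4 :+ m :* con 5 := (con 4 :* l :+ m) :+ m :* con 4) refl [ n ]₄ m))

repunit-positive : ∀ n → 1 ≤ [ n ]₄
repunit-positive zero    = s≤s z≤n
repunit-positive (suc n) = s≤s z≤n

3*repunit : ∀ n → 3 * [ n ]₄ + 1 ≡ 4 * 4 ^ n
3*repunit zero    = refl
3*repunit (suc n) = trans (solve 1 (λ r → con 3 :* (con 1 :+ con 4 :* r) :+ con 1 := con 4 :* (con 3 :* r :+ con 1)) refl [ n ]₄)
  (cong (4 *_) (3*repunit n))
  where open +-*-Solver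

-- As `[ suc n ]₄` is one more than `4 * [ n ]₄`, these intervals follow each other without a gap.
between-repunits : ∀ v → 1 ≤ v → ∃ λ n → [ n ]₄ ≤ v × v ≤ 4 * [ n ]₄
between-repunits (suc zero)    _ = 0 , s≤s z≤n , s≤s z≤n
between-repunits (suc (suc v)) _ with between-repunits (suc v) (s≤s z≤n)
... | n , lo , hi with suc (suc v) ≤? 4 * [ n ]₄
...   | yes hi′ = n , ℕₚ.m≤n⇒m≤1+n lo , hi′
...   | no  v≰  = suc n , ℕₚ.≰⇒> v≰ , ℕₚ.≤-trans (s≤s hi) (ℕₚ.m≤n*m [ suc n ]₄ 4)

parity : ∀ d → ∃ λ m → d ≡ 2 * m ⊎ d ≡ 2 * m + 1
parity zero    = 0 , inj₁ refl
parity (suc d) with parity d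
... | m , inj₁ eq = m , inj₂ (trans (cong suc eq) (ℕₚ.+-comm 1 (2 * m)))
... | m , inj₂ eq = suc m , inj₁ (trans (cong suc eq) (solve 1 (λ m → con 1 :+ (con 2 :* m :+ con 1) := con 2 :* (con 1 :+ m)) refl m))
  where open +-*-Solver

-- With M = `[ n ]₄`, the order `4 * M + 2 * j` is reached by a cone in the regular case. The
-- special j lead to `[ suc n ]₄` plus 1, 3 or 9.
data Decomposition (M : ℕ) : ℕ → Set where
  regular   : ∀ {k m} → k ≤ m → m ≤ M → Decomposition M (3 * m + k)
  special-1 : Decomposition M 1
  special-2 : Decomposition M 2
  special-5 : Decomposition M 5

-- From 3 M on, m = M works. Below, m and k are quotient and remainder modulo 3, and the remainder
-- exceeds the quotient only for 1, 2 and 5.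
decompose : ∀ M j → j ≤ 4 * M → Decomposition M j
decompose M j j≤ with 3 * M ≤? j
... | yes 3M≤j = subst (Decomposition M) (ℕₚ.m+[n∸m]≡n 3M≤j)
  (regular (ℕₚ.m≤n+o⇒m∸n≤o j (3 * M) (subst (j ≤_) (ℕₚ.+-comm M (3 * M)) j≤)) ℕₚ.≤-refl)
... | no 3M≰j with j divMod 3
...   | result q r eq = subst (Decomposition M) (sym (trans eq (trans (ℕₚ.+-comm (toℕ r) (q * 3)) (cong (_+ toℕ r) (ℕₚ.*-comm q 3)))))
  (small q r (ℕₚ.*-cancelˡ-≤ 3 (ℕₚ.≤-trans (ℕₚ.m≤m+n (3 * q) (toℕ r)) (subst (_≤ 3 * M) (trans eq (trans (ℕₚ.+-comm (toℕ r) (q * 3)) (cong (_+ toℕ r) (ℕₚ.*-comm q 3)))) (ℕₚ.≰⇒≥ 3M≰j)))))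
  where
  small : ∀ q (r : Fin 3) → q ≤ M → Decomposition M (3 * q + toℕ r)
  small q             0F q≤ = regular z≤n q≤
  small zero          1F q≤ = special-1
  small (suc q)       1F q≤ = regular (s≤s z≤n) q≤
  small zero          2F q≤ = special-2
  small (suc zero)    2F q≤ = special-5
  small (suc (suc q)) 2F q≤ = regular (s≤s (s≤s z≤n)) q≤

PBDBound-mono : ∀ {v m m′} → m ≤ m′ → PBDBound v m → PBDBound v m′
PBDBound-mono m≤ (D , bound) = D , λ x y z F gen → ℕₚ.≤-trans (bound x y z F gen) m≤

10≤repunit : ∀ n → 10 ≤ [ suc (suc n) ]₄
10≤repunit n = ℕₚ.≤-trans (ℕₚ.m≤m+n 10 11) (s≤s (ℕₚ.*-monoʳ-≤ 4 (s≤s (ℕₚ.*-monoʳ-≤ 4 (repunit-positive n)))))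

-- Here `[ e ]₄ + c` is four times the preceding repunit plus c + 1. At most ten points get weight
-- 5, whence 84 + 10 = 94.
exceptional-PBD : ∀ {v} → Exceptional v → PBDBound v 94
exceptional-PBD (suc (suc (suc e)) , s≤s (s≤s (s≤s _)) , which) = case which of λ where
    (inj₁ refl)        → build 1 (toWitness {a? = 2 ≤? 10} tt)
    (inj₂ (inj₁ refl)) → build 3 (toWitness {a? = 4 ≤? 10} tt)
    (inj₂ (inj₂ refl)) → build 9 (toWitness {a? = 10 ≤? 10} tt)
  where
  build : ∀ c → suc c ≤ 10 → PBDBound ([ suc (suc (suc e)) ]₄ + c) 94
  build c c< = subst (λ v → PBDBound v 94) (ℕₚ.+-suc (4 * [ suc (suc e) ]₄) c)
    (PBDBound-mono (ℕₚ.+-monoʳ-≤ 84 c<) (four-five-PBD (suc (suc e)) (ℕₚ.≤-trans c< (10≤repunit e))))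

tabulated : ∀ {v} → v ≤ 63 → PBD345 v → PBDBound v 63
tabulated v≤ D = D , trivial-bound v≤ D

regular-PBD : ∀ n {k m} → k ≤ m → m ≤ [ n ]₄ → PBDBound (4 * [ n ]₄ + 2 * (3 * m + k)) 63
regular-PBD n k≤m m≤ = realisable-PBD (even-realisable n k≤m m≤)

-- The special cases are exceptional orders once `n` is positive. For `n` zero they are 22, 24 and
-- 30, where the number of points is bound enough.
even-PBD : ∀ n {j} → Decomposition [ suc n ]₄ j → ¬ Exceptional (4 * [ suc n ]₄ + 2 * j) → PBDBound (4 * [ suc n ]₄ + 2 * j) 63
even-PBD n       (regular k≤m m≤) _  = regular-PBD (suc n) k≤m m≤
even-PBD zero    special-1        _  = tabulated (toWitness {a? = 22 ≤? 63} tt) (proj₁ (four-five-PBD 1 {2} (s≤s (s≤s z≤n))))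
even-PBD zero    special-2        _  = tabulated (toWitness {a? = 24 ≤? 63} tt) (proj₁ (four-five-PBD 1 {4} (s≤s (s≤s (s≤s (s≤s z≤n))))))
-- Weights 4 and 5 on the five points of PG(1,4) give at most 25, so 30 has a design of its own.
even-PBD zero    special-5        _  = tabulated (toWitness {a? = 30 ≤? 63} tt) pbd₃₀
even-PBD (suc n) special-1        ¬e = contradiction (suc (suc (suc n)) , s≤s (s≤s (s≤s z≤n)) , inj₁ (ℕₚ.+-suc (4 * [ suc (suc n) ]₄) 1)) ¬e
even-PBD (suc n) special-2        ¬e = contradiction (suc (suc (suc n)) , s≤s (s≤s (s≤s z≤n)) , inj₂ (inj₁ (ℕₚ.+-suc (4 * [ suc (suc n) ]₄) 3))) ¬e
even-PBD (suc n) special-5        ¬e = contradiction (suc (suc (suc n)) , s≤s (s≤s (s≤s z≤n)) , inj₂ (inj₂ (ℕₚ.+-suc (4 * [ suc (suc n) ]₄) 9))) ¬e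

-- The cone over a single point yields 10 and 12; only 14 remains for explicit blocks.
small-even-PBD : ∀ j → 4 + 2 * suc j < 15 → 4 + 2 * suc j ≢ 6 → 4 + 2 * suc j ≢ 8 → PBDBound (4 + 2 * suc j) 63
small-even-PBD 0 _ ≢6 _  = contradiction refl ≢6
small-even-PBD 1 _ _  ≢8 = contradiction refl ≢8
small-even-PBD 2 _ _  _  = regular-PBD 0 {0} {1} z≤n ℕₚ.≤-refl
small-even-PBD 3 _ _  _  = regular-PBD 0 {1} {1} ℕₚ.≤-refl ℕₚ.≤-refl
small-even-PBD 4 _ _  _  = tabulated (toWitness {a? = 14 ≤? 63} tt) pbd₁₄
small-even-PBD (suc (suc (suc (suc (suc j))))) <15 _ _ =
  contradiction <15 (ℕₚ.≤⇒≯ (ℕₚ.≤-trans (ℕₚ.m≤m+n 15 1) (ℕₚ.+-monoʳ-≤ 4 (ℕₚ.*-monoʳ-≤ 2 (ℕₚ.m≤m+n 6 j)))))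

-- By `3*repunit`, 3 M + 1 = 4 p. Were j larger than 4 M, the order would be at least 12 M + 2 = 16
-- p - 2, hence at least 15 p because p is at least 4.
regular-bound : ∀ n j → 4 * [ suc n ]₄ + 2 * j < 15 * 4 ^ suc n → j ≤ 4 * [ suc n ]₄
regular-bound n j v< with j ≤? 4 * [ suc n ]₄
... | yes j≤ = j≤
... | no  j≰ = contradiction v< (ℕₚ.≤⇒≯ (ℕₚ.+-cancelˡ-≤ 4 (15 * p) (4 * M + 2 * j) (begin
    4 + 15 * p                     ≤⟨ ℕₚ.+-monoˡ-≤ (15 * p) (ℕₚ.*-monoʳ-≤ 4 (ℕₚ.m^n>0 4 n)) ⟩
    p + 15 * p                     ≡⟨ ℕₚ.*-assoc 4 4 p ⟩
    4 * (4 * p)                    ≡⟨ cong (4 *_) (3*repunit (suc n)) ⟨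
    4 * (3 * M + 1)                ≡⟨ solve 1 (λ m → con 4 :* (con 3 :* m :+ con 1) := con 2 :+ (con 4 :* m :+ con 2 :* (con 1 :+ con 4 :* m))) refl M ⟩
    2 + (4 * M + 2 * suc (4 * M))  ≤⟨ ℕₚ.+-mono-≤ (ℕₚ.m≤m+n 2 2) (ℕₚ.+-monoʳ-≤ (4 * M) (ℕₚ.*-monoʳ-≤ 2 (ℕₚ.≰⇒> j≰))) ⟩
    4 + (4 * M + 2 * j)            ∎)))
  where
  open ℕₚ.≤-Reasoning
  open +-*-Solver
  M = [ suc n ]₄
  p = 4 ^ suc n

-- A larger m would give an order of at least 3 N + 2, while 3 N + 1 is already `16 * 4 ^ n`.
odd-bound : ∀ n m → [ suc n ]₄ + 2 * m < 15 * 4 ^ n → m ≤ [ suc n ]₄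
odd-bound n m v< with m ≤? [ suc n ]₄
... | yes m≤ = m≤
... | no  m≰ = contradiction v< (ℕₚ.≤⇒≯ (begin
    15 * 4 ^ n              ≤⟨ ℕₚ.*-monoˡ-≤ (4 ^ n) (ℕₚ.m≤m+n 15 1) ⟩
    16 * 4 ^ n              ≡⟨ ℕₚ.*-assoc 4 4 (4 ^ n) ⟩
    4 * 4 ^ suc n           ≡⟨ 3*repunit (suc n) ⟨
    3 * N + 1               ≤⟨ ℕₚ.+-monoʳ-≤ (3 * N) (s≤s z≤n) ⟩
    3 * N + 2               ≡⟨ solve 1 (λ l → con 3 :* l :+ con 2 := l :+ con 2 :* (con 1 :+ l)) refl N ⟩
    N + 2 * suc N           ≤⟨ ℕₚ.+-monoʳ-≤ N (ℕₚ.*-monoʳ-≤ 2 (ℕₚ.≰⇒> m≰)) ⟩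
    N + 2 * m               ∎))
  where
  open ℕₚ.≤-Reasoning
  open +-*-Solver
  N = [ suc n ]₄

-- For `suc n`, orders from `15 * 4 ^ n` on use weights 0 and 1. Below that, the parity of
-- `v ∸ [ suc n ]₄` decides between weights 1 and 3 on PG(n+1,4) and the cone over PG(n,4), with a
-- few small orders treated separately.
generic-PBD : ∀ n v → [ n ]₄ ≤ v → v ≤ 4 * [ n ]₄ → v ≢ 2 → v ≢ 6 → v ≢ 8 → ¬ Exceptional v → PBDBound v 63
generic-PBD zero 1 _ _ _  _ _ _ = realisable-PBD (odd-realisable 0 {0} z≤n)
generic-PBD zero 2 _ _ ≢2 _ _ _ = contradiction refl ≢2
generic-PBD zero 3 _ _ _  _ _ _ = realisable-PBD (odd-realisable 0 {1} ℕₚ.≤-refl)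
generic-PBD zero 4 _ _ _  _ _ _ = regular-PBD 0 {0} {0} z≤n z≤n
generic-PBD zero (suc (suc (suc (suc (suc _))))) _ (s≤s (s≤s (s≤s (s≤s ())))) _ _ _ _
generic-PBD (suc n) v lo hi ≢2 ≢6 ≢8 ¬e with 15 * 4 ^ n ≤? v
... | yes wide = realisable-PBD (wide-realisable n wide (subst (λ k → v ≤ [ k ]₄) (ℕₚ.+-comm 2 n) (ℕₚ.m≤n⇒m≤1+n hi)))
... | no  v≱ with parity (v ∸ [ suc n ]₄)
...   | m , inj₁ eq = subst (λ w → PBDBound w 63) v≡ (realisable-PBD (odd-realisable (suc n) (odd-bound n m (subst (_< 15 * 4 ^ n) (sym v≡) (ℕₚ.≰⇒> v≱)))))
  where
  v≡ : [ suc n ]₄ + 2 * m ≡ v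
  v≡ = trans (cong ([ suc n ]₄ +_) (sym eq)) (ℕₚ.m+[n∸m]≡n lo)
...   | j , inj₂ eq = subst (λ w → PBDBound w 63) v≡ (even n
    (subst (_< 15 * 4 ^ n) (sym v≡) (ℕₚ.≰⇒> v≱)) (≢6 ∘ trans (sym v≡)) (≢8 ∘ trans (sym v≡)) (¬e ∘ subst Exceptional v≡))
  where
  -- The unit in `[ suc n ]₄` = 1 + 4 `[ n ]₄` turns the odd difference 2 j + 1 into the even excess
  -- 2 (j + 1) over 4 `[ n ]₄`.
  v≡ : 4 * [ n ]₄ + 2 * suc j ≡ v
  v≡ = trans (solve 2 (λ m j → con 4 :* m :+ con 2 :* (con 1 :+ j) := (con 1 :+ con 4 :* m) :+ (con 2 :* j :+ con 1)) refl [ n ]₄ j)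
    (trans (cong ([ suc n ]₄ +_) (sym eq)) (ℕₚ.m+[n∸m]≡n lo))
    where open +-*-Solver
  even : ∀ n → let w = 4 * [ n ]₄ + 2 * suc j in w < 15 * 4 ^ n → w ≢ 6 → w ≢ 8 → ¬ Exceptional w → PBDBound w 63
  even zero    w< ≢6 ≢8 _  = small-even-PBD j w< ≢6 ≢8
  even (suc n) w< _  _  ¬e = even-PBD n (decompose [ suc n ]₄ (suc j) (regular-bound n (suc j) w<)) ¬e

theorem1p4 : ∀ (v : ℕ) → 1 ≤ v → v ≢ 2 → v ≢ 6 → v ≢ 8 →
    (¬ Exceptional v → ∃ λ (D : PBD345 v) → ThreeGenBound D 63)
    × (Exceptional v → ∃ λ (D : PBD345 v) → ThreeGenBound D 94)
theorem1p4 v 1≤v ≢2 ≢6 ≢8 =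
  (λ ¬e → let (n , lo , hi) = between-repunits v 1≤v in generic-PBD n v lo hi ≢2 ≢6 ≢8 ¬e) , exceptional-PBD
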